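{- \begin{enumerate} \item $D'(P_\ell)=\ell-1$ for all $\ell\ge 4$. \item $W'(P_\ell)=\ell-2$ for all $\ell\ge 3$. \end{enumerate}
   Context: Graphs are finite and simple; $P_\ell$ is the path on $\ell$ vertices. First-order sentences are over the vocabulary $\{\sim,=\}$ (adjacency and equality). A first-order sentence $\Phi$ defines a class of graphs $\mathcal C$ asymptotically over connected graphs if there is an integer $N$ such that for every connected graph $G$ with at least $N$ vertices, $G\models\Phi$ iff $G\in\mathcal C$. For a graph $F$, let $\mathcal C_F$ be the class of graphs containing a (not necessarily induced) subgraph isomorphic to $F$. $D'(F)$ is the minimum quantifier depth of a sentence defining $\mathcal C_F$ asymptotically over connected graphs, and $W'(F)$ is the minimum variable width (number of distinct first-order variables used) of such a sentence. -}

module Defs where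

open import Data.Nat using (ℕ; zero; suc; _≤_; _⊔_; _≡ᵇ_; _∸_)
open import Data.Nat.Properties using (_≟_)
open import Data.Fin using (Fin; toℕ)
open import Data.Bool using (Bool; true; false; _∨_)
open import Data.Bool.Properties using (∨-comm)
open import Data.List using (List; []; _∷_; _++_; filter; length; deduplicate)
open import Data.Maybe using (Maybe; just; nothing)
open import Data.Product using (Σ; _×_; _,_; ∃)
open import Data.Empty using (⊥)
open import Data.Sum using (_⊎_)
open import Relation.Nullary using (¬_; yes; no)
open import Relation.Nullary.Decidable using (¬?)
open import Relation.Binary.PropositionalEquality using (_≡_; refl)
open import Function.Definitions using (Injective)
open import Function.Bundles using (_⇔_)

record Graph : Set where
  field
    size  : ℕ
    adj   : Fin size → Fin size → Bool
    sym   : ∀ u v → adj u v ≡ adj v u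
    irrefl : ∀ u → adj u u ≡ false
open Graph public

pathAdj : (ℓ : ℕ) → Fin ℓ → Fin ℓ → Bool
pathAdj ℓ i j = (suc (toℕ i) ≡ᵇ toℕ j) ∨ (suc (toℕ j) ≡ᵇ toℕ i)

private
  suc≢ᵇ : ∀ m → (suc m ≡ᵇ m) ≡ false
  suc≢ᵇ zero = refl
  suc≢ᵇ (suc m) = suc≢ᵇ m

P : ℕ → Graph
P ℓ = record
  { size = ℓ
  ; adj = pathAdj ℓ
  ; sym = λ i j → ∨-comm (suc (toℕ i) ≡ᵇ toℕ j) (suc (toℕ j) ≡ᵇ toℕ i)
  ; irrefl = λ i → irr (toℕ i)
  }
  where
  irr : ∀ m → ((suc m ≡ᵇ m) ∨ (suc m ≡ᵇ m)) ≡ false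
  irr m with suc m ≡ᵇ m | suc≢ᵇ m
  ... | false | refl = refl

ContainsSubgraph : Graph → Graph → Set
ContainsSubgraph F G =
  Σ (Fin (size F) → Fin (size G)) λ f →
    Injective _≡_ _≡_ f ×
    (∀ u v → adj F u v ≡ true → adj G (f u) (f v) ≡ true)

data Reach (G : Graph) : Fin (size G) → Fin (size G) → Set where
  here : ∀ u → Reach G u u
  step : ∀ u v w → adj G u v ≡ true → Reach G v w → Reach G u w

Connected : Graph → Set
Connected G = ∀ u v → Reach G u v

data Formula : Set where
  _~'_ : ℕ → ℕ → Formula
  _='_ : ℕ → ℕ → Formula
  ¬'_  : Formula → Formula
  _∧'_ : Formula → Formula → Formula
  _∨'_ : Formula → Formula → Formula
  ∃'   : ℕ → Formula → Formula
  ∀'   : ℕ → Formula → Formula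

depth : Formula → ℕ
depth (x ~' y) = 0
depth (x =' y) = 0
depth (¬' φ) = depth φ
depth (φ ∧' ψ) = depth φ ⊔ depth ψ
depth (φ ∨' ψ) = depth φ ⊔ depth ψ
depth (∃' x φ) = suc (depth φ)
depth (∀' x φ) = suc (depth φ)

vars : Formula → List ℕ
vars (x ~' y) = x ∷ y ∷ []
vars (x =' y) = x ∷ y ∷ []
vars (¬' φ) = vars φ
vars (φ ∧' ψ) = vars φ ++ vars ψ
vars (φ ∨' ψ) = vars φ ++ vars ψ
vars (∃' x φ) = x ∷ vars φ
vars (∀' x φ) = x ∷ vars φ

width : Formula → ℕ
width φ = length (deduplicate _≟_ (vars φ))

fv : Formula → List ℕ
fv (x ~' y) = x ∷ y ∷ []
fv (x =' y) = x ∷ y ∷ []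
fv (¬' φ) = fv φ
fv (φ ∧' ψ) = fv φ ++ fv ψ
fv (φ ∨' ψ) = fv φ ++ fv ψ
fv (∃' x φ) = filter (λ y → ¬? (y ≟ x)) (fv φ)
fv (∀' x φ) = filter (λ y → ¬? (y ≟ x)) (fv φ)

Sentence : Formula → Set
Sentence φ = fv φ ≡ []

Env : Graph → Set
Env G = ℕ → Maybe (Fin (size G))

update : {G : Graph} → Env G → ℕ → Fin (size G) → Env G
update ρ x v y with y ≟ x
... | yes _ = just v
... | no _ = ρ y

AdjM : (G : Graph) → Maybe (Fin (size G)) → Maybe (Fin (size G)) → Set
AdjM G (just u) (just v) = adj G u v ≡ true
AdjM G _ _ = ⊥

EqM : (G : Graph) → Maybe (Fin (size G)) → Maybe (Fin (size G)) → Set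
EqM G (just u) (just v) = u ≡ v
EqM G _ _ = ⊥

Eval : (G : Graph) → Formula → Env G → Set
Eval G (x ~' y) ρ = AdjM G (ρ x) (ρ y)
Eval G (x =' y) ρ = EqM G (ρ x) (ρ y)
Eval G (¬' φ) ρ = ¬ Eval G φ ρ
Eval G (φ ∧' ψ) ρ = Eval G φ ρ × Eval G ψ ρ
Eval G (φ ∨' ψ) ρ = Eval G φ ρ ⊎ Eval G ψ ρ
Eval G (∃' x φ) ρ = Σ (Fin (size G)) λ v → Eval G φ (update {G} ρ x v)
Eval G (∀' x φ) ρ = (v : Fin (size G)) → Eval G φ (update {G} ρ x v)

-- G ⊨ Φ (for sentences the initial assignment is irrelevant)
_⊨_ : Graph → Formula → Set
G ⊨ Φ = Eval G Φ (λ _ → nothing)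

DefinesAsympConn : Formula → Graph → Set
DefinesAsympConn Φ F =
  Sentence Φ ×
  Σ ℕ λ N → (G : Graph) → Connected G → N ≤ size G →
    (G ⊨ Φ) ⇔ ContainsSubgraph F G

IsD' : Graph → ℕ → Set
IsD' F d =
  (Σ Formula λ Φ → DefinesAsympConn Φ F × depth Φ ≡ d) ×
  (∀ Φ → DefinesAsympConn Φ F → d ≤ depth Φ)

IsW' : Graph → ℕ → Set
IsW' F w =
  (Σ Formula λ Φ → DefinesAsympConn Φ F × width Φ ≡ w) ×
  (∀ Φ → DefinesAsympConn Φ F → w ≤ width Φ)

{-# OPTIONS --safe #-}
module Submission where

-- Lower bounds. Let S a be a clique on a + 1 vertices with many pendant vertices attached to
-- one clique vertex, the center. S (ℓ - 2) contains P ℓ and S (ℓ - 3) does not. Telling them apart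
-- requires ℓ - 2 pebbles on the non-central clique vertices, and one more round
-- to see that none of these pebbles is on the center.
--
-- Upper bounds. A path on ℓ - 2 vertices whose two ends both have a neighbour outside the path
-- yields P ℓ in a connected graph with at least ℓ vertices: if the only outside neighbour is
-- the same for both ends, then there is a cycle on ℓ - 1 vertices, to which a further vertex is attached.
-- This takes depth ℓ - 1. To save a variable, the outside neighbour y of an end e re-uses
-- the variable of a path vertex p from which y differs in adjacency to e or in
-- having a neighbour at distance 2 from e. If there is no such p, then either e is adjacent
-- to all vertices, or e is adjacent to the whole path and all other vertices of the path have
-- a neighbour at distance 2 from e; rotating the cycle then gives P ℓ as before.

open import Defs
open import Data.Nat using (ℕ; _≤_; _∸_; zero; suc; _+_; _<_; _≡ᵇ_; _<?_; z≤n; s≤s; z<s; s<s; s≤s⁻¹)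
open import Data.Nat.Properties as ℕₚ using (_≟_)
open import Data.Fin using (Fin; zero; suc; toℕ; fromℕ<)
import Data.Fin.Properties as Finₚ
open import Data.Bool using (Bool; true; false; not; _∧_; T)
import Data.Bool.Properties as Boolₚ
open import Data.List using (List; []; _∷_; _++_; [_]; filter; length; deduplicate; lookup; map; applyUpTo; upTo)
import Data.List.Properties as Listₚ
open import Data.List.Membership.Propositional using (_∈_; _∉_; find; lose)
import Data.List.Membership.Propositional.Properties as ∈ₚ
import Data.List.Membership.Setoid.Properties as ∈-Setoid
import Data.List.Membership.DecPropositional as DecMembership
import Data.List.Relation.Unary.Any as Any
open import Data.List.Relation.Unary.All as All using (All; []; _∷_)
import Data.List.Relation.Unary.All.Properties as Allₚ
open import Data.List.Relation.Unary.AllPairs using ([]; _∷_)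
open import Data.List.Relation.Unary.Unique.Propositional using (Unique)
import Data.List.Relation.Unary.Unique.Propositional.Properties as Uniqueₚ
import Data.List.Relation.Unary.Unique.DecPropositional.Properties as DecUniqueₚ
open import Data.List.Relation.Binary.Permutation.Propositional using (_↭_; ↭-sym; ↭-refl; ↭⇒↭ₛ)
import Data.List.Relation.Binary.Permutation.Propositional.Properties as ↭ₚ
import Data.List.Relation.Binary.Permutation.Setoid.Properties as ↭-Setoid
open import Data.Maybe using (just)
open import Data.Product using (_×_; ∃; ∃₂; _,_; proj₁; proj₂)
open import Data.Sum using (_⊎_; inj₁; inj₂)
open import Data.Empty using (⊥)
open import Relation.Nullary using (¬_; Dec; yes; no; does; contradiction)
open import Relation.Nullary.Decidable using (¬?; does-⇔; _×-dec_; _⊎-dec_; decidable-stable; toWitness)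
open import Relation.Unary using (Decidable)
open import Relation.Binary.Definitions using (tri<; tri≈; tri>)
open import Relation.Binary.PropositionalEquality as ≡ using (_≡_; _≢_; refl; cong; cong₂; subst; trans)
open import Function using (_∘_; id)
open import Function.Definitions using (Injective)
open import Function.Bundles using (_⇔_; mk⇔; Equivalence)
import Function.Properties.Equivalence as ⇔ₚ
open Equivalence using (to; from)

V : Graph → Set
V G = Fin (size G)

infix 4 _[_~_]
_[_~_] : (G : Graph) → V G → V G → Set
G [ u ~ v ] = adj G u v ≡ true

~-sym : ∀ G {u v} → G [ u ~ v ] → G [ v ~ u ]
~-sym G {u} {v} u~v = trans (sym G v u) u~v

~⇒≢ : ∀ G {u v} → G [ u ~ v ] → u ≢ v
~⇒≢ G {u} u~u refl = contradiction (trans (≡.sym u~u) (irrefl G u)) λ ()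

-- The pigeonhole principle

module _ {n : ℕ} where
  open DecMembership (Finₚ._≟_ {n}) public using () renaming (_∈?_ to _∈ᶠ?_)

-- Otherwise sending `i` to the position of `e i` in `xs` would inject `k` points into fewer than
-- `k`.
fresh : ∀ {k n} (e : Fin k → Fin n) → Injective _≡_ _≡_ e →
        (xs : List (Fin n)) → length xs < k → ∃ λ i → e i ∉ xs
fresh e e-inj xs xs<k with Finₚ.any? (λ i → ¬? (e i ∈ᶠ? xs))
... | yes found = found
... | no none = contradiction (Finₚ.injective⇒≤ {f = position} position-injective) (ℕₚ.<⇒≱ xs<k)
  where
  e∈xs : ∀ i → e i ∈ xs
  e∈xs i = decidable-stable (e i ∈ᶠ? xs) (λ e∉xs → none (i , e∉xs))
  position : Fin _ → Fin (length xs)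
  position i = Any.index (e∈xs i)
  position-injective : Injective _≡_ _≡_ position
  position-injective {i} {j} eq = e-inj (∈-Setoid.index-injective (≡.setoid _) (e∈xs i) (e∈xs j) eq)

vertexOutside : ∀ {n} (xs : List (Fin n)) → length xs < n → ∃ λ v → v ∉ xs
vertexOutside = fresh id id

unique-lookup-injective : ∀ {A : Set} {xs : List A} → Unique xs → Injective _≡_ _≡_ (lookup xs)
unique-lookup-injective (_ ∷ _) {zero} {zero} _ = refl
unique-lookup-injective (x∉ ∷ _) {zero} {suc j} eq = contradiction eq (All.lookup x∉ (∈ₚ.∈-lookup j))
unique-lookup-injective (x∉ ∷ _) {suc i} {zero} eq = contradiction (≡.sym eq) (All.lookup x∉ (∈ₚ.∈-lookup i))
unique-lookup-injective (_ ∷ xs!) {suc i} {suc j} eq = cong suc (unique-lookup-injective xs! eq)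

unique-bounded-length : ∀ {k} {xs : List ℕ} → Unique xs → All (_< k) xs → length xs ≤ k
unique-bounded-length {k} {xs} xs! xs<k = Finₚ.injective⇒≤ {f = f} f-injective
  where
  bound : ∀ i → lookup xs i < k
  bound i = All.lookup xs<k (∈ₚ.∈-lookup i)
  f : Fin (length xs) → Fin k
  f i = fromℕ< (bound i)
  f-injective : Injective _≡_ _≡_ f
  f-injective {i} {j} eq = unique-lookup-injective xs!
    (Finₚ.fromℕ<-injective _ _ (bound i) (bound j) eq)

-- Paths in connected graphs

data Walk (G : Graph) : V G → List (V G) → V G → Set where
  stop : ∀ u → Walk G u [ u ] u
  go   : ∀ {u v w xs} → G [ u ~ v ] → Walk G v xs w → Walk G u (u ∷ xs) w

HasPath : Graph → ℕ → Set
HasPath G n = ∃₂ λ u xs → ∃ λ v → Walk G u xs v × Unique xs × length xs ≡ n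

module _ {G : Graph} where

  walk-start : ∀ {u xs v} → Walk G u xs v → u ∈ xs
  walk-start (stop u) = Any.here refl
  walk-start (go _ _) = Any.here refl

  walk-++ : ∀ {u xs v w ys t} → Walk G u xs v → G [ v ~ w ] → Walk G w ys t → Walk G u (xs ++ ys) t
  walk-++ (stop u) v~w q = go v~w q
  walk-++ (go a p) v~w q = go a (walk-++ p v~w q)

  -- Cut the closed walk just before `c` and rejoin the two pieces by the closing edge from `v` to
  -- `u`.
  rotate : ∀ {u xs v c} → Walk G u xs v → G [ v ~ u ] → c ∈ xs →
           ∃₂ λ ys t → Walk G c ys t × xs ↭ ys
  rotate p v~u c∈xs with split p c∈xs
    where
    split : ∀ {u xs v c} → Walk G u xs v → c ∈ xs →
            c ≡ u ⊎ ∃₂ λ as a → ∃ λ bs → Walk G u as a × G [ a ~ c ] × Walk G c bs v × xs ≡ as ++ bs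
    split (stop u) (Any.here refl) = inj₁ refl
    split (go _ _) (Any.here refl) = inj₁ refl
    split (go {u} u~v p) (Any.there c∈xs) with split p c∈xs
    ... | inj₁ refl = inj₂ ([ u ] , u , _ , stop u , u~v , p , refl)
    ... | inj₂ (as , a , bs , q , a~c , r , eq) =
      inj₂ (u ∷ as , a , bs , go u~v q , a~c , r , cong (u ∷_) eq)
  ... | inj₁ refl = _ , _ , p , ↭-refl
  ... | inj₂ (as , a , bs , q , a~c , r , refl) = bs ++ as , a , walk-++ r v~u q , ↭ₚ.++-comm as bs

  unique-resp-↭ : {xs ys : List (V G)} → xs ↭ ys → Unique xs → Unique ys
  unique-resp-↭ = ↭-Setoid.Unique-resp-↭ (≡.setoid _) ∘ ↭⇒↭ₛ

  unique-∷ : ∀ {x} {xs : List (V G)} → x ∉ xs → Unique xs → Unique (x ∷ xs)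
  unique-∷ x∉xs xs! = Allₚ.¬Any⇒All¬ _ x∉xs ∷ xs!

  -- This is how connectivity enters all the upper bounds: `Q` will be a cycle, a closed
  -- neighbourhood or a single vertex.
  boundaryEdge : ∀ {Q : V G → Set} → Decidable Q → ∀ {u w} → Reach G u w → Q u → ¬ Q w →
                 ∃₂ λ c d → Q c × ¬ Q d × G [ c ~ d ]
  boundaryEdge Q? (here u) Qu ¬Qw = contradiction Qu ¬Qw
  boundaryEdge Q? (step u v w u~v r) Qu ¬Qw with Q? v
  ... | yes Qv = boundaryEdge Q? r Qv ¬Qw
  ... | no ¬Qv = u , v , Qu , ¬Qv , u~v

  -- There is a vertex off the cycle, so some edge `c ~ d` leaves the cycle; opened so as to start
  -- at `c`, the cycle is prolonged by `d`.
  cycle⇒path : Connected G → ∀ {u xs v} → length xs < size G →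
               Walk G u xs v → Unique xs → G [ v ~ u ] → HasPath G (suc (length xs))
  cycle⇒path conn {u} {xs} xs<n p xs! v~u
    with t , t∉xs ← vertexOutside xs xs<n
    with c , d , c∈xs , d∉xs , c~d ← boundaryEdge (_∈ᶠ? xs) (conn u t) (walk-start p) t∉xs
    with ys , e , q , xs↭ys ← rotate p v~u c∈xs
    = d , d ∷ ys , e , go (~-sym G c~d) q
    , unique-∷ (d∉xs ∘ ↭ₚ.∈-resp-↭ (↭-sym xs↭ys)) (unique-resp-↭ xs↭ys xs!)
    , cong suc (≡.sym (↭ₚ.↭-length xs↭ys))

  -- If both ends have the same outside neighbour, the path closes to a cycle,
  -- and connectivity supplies a further vertex adjacent to that cycle.
  extendBothEnds : Connected G → ∀ {u xs v y z} → 2 + length xs ≤ size G →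
                   Walk G u xs v → Unique xs → y ∉ xs → G [ y ~ u ] → z ∉ xs → G [ v ~ z ] →
                   HasPath G (2 + length xs)
  extendBothEnds conn {u} {xs} {v} {y} {z} big p xs! y∉xs y~u z∉xs v~z with y Finₚ.≟ z
  ... | yes refl = cycle⇒path conn big (go y~u p) (unique-∷ y∉xs xs!) v~z
  ... | no y≢z = y , y ∷ xs ++ [ z ] , z , go y~u (walk-++ p v~z (stop z))
      , unique-∷ y∉ (Uniqueₚ.++⁺ xs! ([] ∷ []) λ { (x∈xs , Any.here refl) → z∉xs x∈xs })
      , cong suc (trans (Listₚ.length-++ xs) (ℕₚ.+-comm (length xs) 1))
    where
    y∉ : y ∉ xs ++ [ z ]
    y∉ y∈ with ∈ₚ.∈-++⁻ xs y∈
    ... | inj₁ y∈xs = y∉xs y∈xs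
    ... | inj₂ (Any.here y≡z) = y≢z y≡z

  walk-lookup : ∀ {u xs v} → Walk G u xs v → ∀ i j → suc (toℕ i) ≡ toℕ j → G [ lookup xs i ~ lookup xs j ]
  walk-lookup (stop u) zero zero ()
  walk-lookup (go u~v (stop _)) zero (suc zero) refl = u~v
  walk-lookup (go u~v (go _ _)) zero (suc zero) refl = u~v
  walk-lookup (go u~v p) (suc i) (suc j) eq = walk-lookup p i j (ℕₚ.suc-injective eq)

-- Paths as subgraphs, as walks and as sequences of vertices

pathAdj⁻ : ∀ {ℓ} (i j : Fin ℓ) → adj (P ℓ) i j ≡ true → suc (toℕ i) ≡ toℕ j ⊎ suc (toℕ j) ≡ toℕ i
pathAdj⁻ i j i~j with suc (toℕ i) ≡ᵇ toℕ j in eq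
... | true = inj₁ (ℕₚ.≡ᵇ⇒≡ _ _ (subst T (≡.sym eq) _))
... | false = inj₂ (ℕₚ.≡ᵇ⇒≡ _ _ (subst T (≡.sym i~j) _))

pathAdj⁺ : ∀ {ℓ} (i j : Fin ℓ) → suc (toℕ i) ≡ toℕ j → adj (P ℓ) i j ≡ true
pathAdj⁺ i j eq with suc (toℕ i) ≡ᵇ toℕ j | ℕₚ.≡⇒≡ᵇ _ _ eq
... | true | _ = refl

hasPath⇒contains : ∀ {G ℓ} → HasPath G ℓ → ContainsSubgraph (P ℓ) G
hasPath⇒contains {G} (u , xs , v , p , xs! , refl) =
  lookup xs , unique-lookup-injective xs! , edges
  where
  edges : ∀ i j → adj (P (length xs)) i j ≡ true → G [ lookup xs i ~ lookup xs j ]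
  edges i j i~j with pathAdj⁻ i j i~j
  ... | inj₁ eq = walk-lookup p i j eq
  ... | inj₂ eq = ~-sym G (walk-lookup p j i eq)

-- Only the values at arguments below n matter.
record IsPath (G : Graph) (n : ℕ) (f : ℕ → V G) : Set where
  field
    adjacent : ∀ i → suc i < n → G [ f i ~ f (suc i) ]
    distinct : ∀ i j → i < j → j < n → f i ≢ f j
open IsPath

module _ {G : Graph} where

  distinct-≢ : ∀ {n f} → IsPath G n f → ∀ {i j} → i < n → j < n → i ≢ j → f i ≢ f j
  distinct-≢ p {i} {j} i<n j<n i≢j with ℕₚ.<-cmp i j
  ... | tri< i<j _ _ = distinct p i j i<j j<n
  ... | tri≈ _ i≡j _ = contradiction i≡j i≢j
  ... | tri> _ _ j<i = distinct p j i j<i i<n ∘ ≡.sym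

  tail-path : ∀ {n f} → IsPath G (suc n) f → IsPath G n (f ∘ suc)
  tail-path p .adjacent i i<n = adjacent p (suc i) (s<s i<n)
  tail-path p .distinct i j i<j j<n = distinct p (suc i) (suc j) (s<s i<j) (s<s j<n)

  init-path : ∀ {n f} → IsPath G (suc n) f → IsPath G n f
  init-path p .adjacent i i<n = adjacent p i (ℕₚ.m<n⇒m<1+n i<n)
  init-path p .distinct i j i<j j<n = distinct p i j i<j (ℕₚ.m<n⇒m<1+n j<n)

  path-walk : ∀ {n f} → IsPath G (suc n) f → Walk G (f 0) (applyUpTo f (suc n)) (f n)
  path-walk {zero} {f} p = stop (f 0)
  path-walk {suc n} p = go (adjacent p 0 (s<s z<s)) (path-walk (tail-path p))

  path-unique : ∀ {n f} → IsPath G n f → Unique (applyUpTo f n)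
  path-unique {n} {f} p = Uniqueₚ.applyUpTo⁺₁ f n (λ {i} {j} → distinct p i j)

contains⇒path : ∀ {G n} → ContainsSubgraph (P (suc n)) G → ∃ (IsPath G (suc n))
contains⇒path {G} {n} (e , e-inj , edges) = f , record
  { adjacent = λ i 1+i<ℓ → let i<ℓ = ℕₚ.<-trans (ℕₚ.n<1+n i) 1+i<ℓ in
      ≡.subst₂ (G [_~_]) (≡.sym (f-fromℕ< i<ℓ)) (≡.sym (f-fromℕ< 1+i<ℓ))
        (edges _ _ (pathAdj⁺ _ _
          (trans (cong suc (Finₚ.toℕ-fromℕ< i<ℓ)) (≡.sym (Finₚ.toℕ-fromℕ< 1+i<ℓ)))))
  ; distinct = λ i j i<j j<ℓ fi≡fj → let i<ℓ = ℕₚ.<-trans i<j j<ℓ in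
      ℕₚ.<⇒≢ i<j (Finₚ.fromℕ<-injective _ _ i<ℓ j<ℓ
        (e-inj (trans (≡.sym (f-fromℕ< i<ℓ)) (trans fi≡fj (f-fromℕ< j<ℓ)))))
  }
  where
  f : ℕ → V G
  f i with i <? suc n
  ... | yes i<ℓ = e (fromℕ< i<ℓ)
  -- A default value past the end of the path.
  ... | no _ = e zero
  f-fromℕ< : ∀ {i} (i<ℓ : i < suc n) → f i ≡ e (fromℕ< i<ℓ)
  f-fromℕ< {i} i<ℓ with i <? suc n
  ... | yes _ = refl
  ... | no i≮ℓ = contradiction i<ℓ i≮ℓ

-- Total valuations and back-and-forth systems

_[_≔_] : {A : Set} → (ℕ → A) → ℕ → A → ℕ → A
(f [ x ≔ v ]) y with y ≟ x
... | yes _ = v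
... | no _ = f y

module _ {A : Set} {f : ℕ → A} where

  ≔-same : ∀ x {v} → (f [ x ≔ v ]) x ≡ v
  ≔-same x with x ≟ x
  ... | yes _ = refl
  ... | no x≢x = contradiction refl x≢x

  ≔-other : ∀ {x v y} → y ≢ x → (f [ x ≔ v ]) y ≡ f y
  ≔-other {x} {v} {y} y≢x with y ≟ x
  ... | yes y≡x = contradiction y≡x y≢x
  ... | no _ = refl

  ≔-id : ∀ x y → f y ≡ (f [ x ≔ f x ]) y
  ≔-id x y with y ≟ x
  ... | yes refl = refl
  ... | no _ = refl

-- Satisfaction under total valuations, which removes the undefined cases of `Eval`; on sentences
-- the two agree by `⊨⇔sat`.
Sat : (G : Graph) → Formula → (ℕ → V G) → Set
Sat G (x ~' y) f = G [ f x ~ f y ]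
Sat G (x =' y) f = f x ≡ f y
Sat G (¬' φ) f = ¬ Sat G φ f
Sat G (φ ∧' ψ) f = Sat G φ f × Sat G ψ f
Sat G (φ ∨' ψ) f = Sat G φ f ⊎ Sat G ψ f
Sat G (∃' x φ) f = ∃ λ v → Sat G φ (f [ x ≔ v ])
Sat G (∀' x φ) f = ∀ v → Sat G φ (f [ x ≔ v ])

sat? : ∀ G φ f → Dec (Sat G φ f)
sat? G (x ~' y) f = adj G (f x) (f y) Boolₚ.≟ true
sat? G (x =' y) f = f x Finₚ.≟ f y
sat? G (¬' φ) f = ¬? (sat? G φ f)
sat? G (φ ∧' ψ) f = sat? G φ f ×-dec sat? G ψ f
sat? G (φ ∨' ψ) f = sat? G φ f ⊎-dec sat? G ψ f
sat? G (∃' x φ) f = Finₚ.any? (λ v → sat? G φ (f [ x ≔ v ]))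
sat? G (∀' x φ) f = Finₚ.all? (λ v → sat? G φ (f [ x ≔ v ]))

module _ {A B : Set} (e : A ⇔ B) where
  ¬-⇔ : (¬ A) ⇔ (¬ B)
  ¬-⇔ = mk⇔ (_∘ from e) (_∘ to e)

  ×-⇔ : ∀ {C D : Set} → C ⇔ D → (A × C) ⇔ (B × D)
  ×-⇔ e′ = mk⇔ (λ (a , c) → to e a , to e′ c) (λ (b , d) → from e b , from e′ d)

  ⊎-⇔ : ∀ {C D : Set} → C ⇔ D → (A ⊎ C) ⇔ (B ⊎ D)
  ⊎-⇔ e′ = mk⇔ (λ { (inj₁ a) → inj₁ (to e a) ; (inj₂ c) → inj₂ (to e′ c) })
               (λ { (inj₁ b) → inj₁ (from e b) ; (inj₂ d) → inj₂ (from e′ d) })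

∃-⇔ : ∀ {A B : Set} {C : A → Set} {D : B → Set} →
      (∀ a → ∃ λ b → C a ⇔ D b) → (∀ b → ∃ λ a → C a ⇔ D b) → ∃ C ⇔ ∃ D
∃-⇔ forth back = mk⇔
  (λ (a , c) → let b , e = forth a in b , to e c)
  (λ (b , d) → let a , e = back b in a , from e d)

∀-⇔ : ∀ {A B : Set} {C : A → Set} {D : B → Set} →
      (∀ a → ∃ λ b → C a ⇔ D b) → (∀ b → ∃ λ a → C a ⇔ D b) → (∀ a → C a) ⇔ (∀ b → D b)
∀-⇔ forth back = mk⇔
  (λ c b → let a , e = back b in to e (c a))
  (λ d a → let b , e = forth a in from e (d b))

bound-fv : ∀ x φ {y} → y ∈ fv φ → y ≢ x → y ∈ fv (∃' x φ)
bound-fv x φ = ∈ₚ.∈-filter⁺ (λ y → ¬? (y ≟ x))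

eval⇔sat : ∀ G φ {ρ f} → (∀ {x} → x ∈ fv φ → ρ x ≡ just (f x)) → Eval G φ ρ ⇔ Sat G φ f
eval⇔sat-≔ : ∀ G x φ {ρ f} → (∀ {y} → y ∈ fv (∃' x φ) → ρ y ≡ just (f y)) →
             ∀ v → Eval G φ (update {G} ρ x v) ⇔ Sat G φ (f [ x ≔ v ])

eval⇔sat G (x ~' y) {ρ} agree
  with ρ x | ρ y | agree {x} (Any.here refl) | agree {y} (Any.there (Any.here refl))
... | _ | _ | refl | refl = ⇔ₚ.refl
eval⇔sat G (x =' y) {ρ} agree
  with ρ x | ρ y | agree {x} (Any.here refl) | agree {y} (Any.there (Any.here refl))
... | _ | _ | refl | refl = ⇔ₚ.refl
eval⇔sat G (¬' φ) agree = ¬-⇔ (eval⇔sat G φ agree)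
eval⇔sat G (φ ∧' ψ) agree =
  ×-⇔ (eval⇔sat G φ (agree ∘ ∈ₚ.∈-++⁺ˡ)) (eval⇔sat G ψ (agree ∘ ∈ₚ.∈-++⁺ʳ (fv φ)))
eval⇔sat G (φ ∨' ψ) agree =
  ⊎-⇔ (eval⇔sat G φ (agree ∘ ∈ₚ.∈-++⁺ˡ)) (eval⇔sat G ψ (agree ∘ ∈ₚ.∈-++⁺ʳ (fv φ)))
eval⇔sat G (∃' x φ) agree = ∃-⇔ (λ v → v , eval⇔sat-≔ G x φ agree v) (λ v → v , eval⇔sat-≔ G x φ agree v)
eval⇔sat G (∀' x φ) agree = ∀-⇔ (λ v → v , eval⇔sat-≔ G x φ agree v) (λ v → v , eval⇔sat-≔ G x φ agree v)

eval⇔sat-≔ G x φ {ρ} {f} agree v = eval⇔sat G φ agree′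
  where
  agree′ : ∀ {y} → y ∈ fv φ → update {G} ρ x v y ≡ just ((f [ x ≔ v ]) y)
  agree′ {y} y∈ with y ≟ x
  ... | yes _ = refl
  ... | no y≢x = agree (bound-fv x φ y∈ y≢x)

-- The assignment `just ∘ f` agrees with both valuations, so both satisfactions are equivalent to
-- the same `Eval`.
sat-cong : ∀ G φ {f g} → (∀ x → f x ≡ g x) → Sat G φ f → Sat G φ g
sat-cong G φ f≗g = to (eval⇔sat G φ {ρ = just ∘ _} (λ {x} _ → cong just (f≗g x))) ∘ from (eval⇔sat G φ (λ _ → refl))

⊨⇔sat : ∀ G Φ → Sentence Φ → ∀ f → (G ⊨ Φ) ⇔ Sat G Φ f
⊨⇔sat G Φ closed f = eval⇔sat G Φ λ x∈ → contradiction (subst (_ ∈_) closed x∈) λ ()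

-- The Ehrenfeucht–Fraïssé method: Pos φ relates valuations
-- from which the truth value of φ cannot be told apart.
record BackAndForth (G H : Graph) : Set₁ where
  field
    Pos     : Formula → (ℕ → V G) → (ℕ → V H) → Set
    pos-~   : ∀ {x y f g} → Pos (x ~' y) f g → adj G (f x) (f y) ≡ adj H (g x) (g y)
    pos-=   : ∀ {x y f g} → Pos (x =' y) f g → (f x ≡ f y) ⇔ (g x ≡ g y)
    pos-¬   : ∀ {φ f g} → Pos (¬' φ) f g → Pos φ f g
    pos-∧   : ∀ {φ ψ f g} → Pos (φ ∧' ψ) f g → Pos φ f g × Pos ψ f g
    pos-∨   : ∀ {φ ψ f g} → Pos (φ ∨' ψ) f g → Pos φ f g × Pos ψ f g
    -- Both quantifiers call for the same moves, so these are only stated for `∃'`.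
    pos-∀   : ∀ {x φ f g} → Pos (∀' x φ) f g → Pos (∃' x φ) f g
    forth   : ∀ {x φ f g} → Pos (∃' x φ) f g → ∀ v → ∃ λ w → Pos φ (f [ x ≔ v ]) (g [ x ≔ w ])
    back    : ∀ {x φ f g} → Pos (∃' x φ) f g → ∀ w → ∃ λ v → Pos φ (f [ x ≔ v ]) (g [ x ≔ w ])

  transfer : ∀ φ {f g} → Pos φ f g → Sat G φ f ⇔ Sat H φ g
  transfer (x ~' y) p = mk⇔ (trans (≡.sym (pos-~ p))) (trans (pos-~ p))
  transfer (x =' y) p = pos-= p
  transfer (¬' φ) p = ¬-⇔ (transfer φ (pos-¬ p))
  transfer (φ ∧' ψ) p = let q , r = pos-∧ p in ×-⇔ (transfer φ q) (transfer ψ r)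
  transfer (φ ∨' ψ) p = let q , r = pos-∨ p in ⊎-⇔ (transfer φ q) (transfer ψ r)
  transfer (∃' x φ) p = ∃-⇔
    (λ v → let w , q = forth p v in w , transfer φ q)
    (λ w → let v , q = back p w in v , transfer φ q)
  transfer (∀' x φ) p = ∀-⇔
    (λ v → let w , q = forth (pos-∀ p) v in w , transfer φ q)
    (λ w → let v , q = back (pos-∀ p) w in v , transfer φ q)

-- Cliques with pendant vertices

data Kind : Set where
  center clique leaf : Kind

kind : ℕ → ℕ → Kind
kind a zero = center
kind zero (suc x) = leaf
kind (suc a) (suc zero) = clique
kind (suc a) (suc (suc x)) = kind a (suc x)

-- Adjacency between distinct vertices of the given kinds; `Sparkler` excludes the loops.
joined : Kind → Kind → Bool
joined center _ = true
joined clique center = true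
joined clique clique = true
joined clique leaf = false
joined leaf center = true
joined leaf _ = false

joined-sym : ∀ κ κ′ → joined κ κ′ ≡ joined κ′ κ
joined-sym center center = refl
joined-sym center clique = refl
joined-sym center leaf = refl
joined-sym clique center = refl
joined-sym clique clique = refl
joined-sym clique leaf = refl
joined-sym leaf center = refl
joined-sym leaf clique = refl
joined-sym leaf leaf = refl

_≟ᵏ_ : (κ κ′ : Kind) → Dec (κ ≡ κ′)
center ≟ᵏ center = yes refl
center ≟ᵏ clique = no λ ()
center ≟ᵏ leaf = no λ ()
clique ≟ᵏ center = no λ ()
clique ≟ᵏ clique = yes refl
clique ≟ᵏ leaf = no λ ()
leaf ≟ᵏ center = no λ ()
leaf ≟ᵏ clique = no λ ()
leaf ≟ᵏ leaf = yes refl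

kind-clique⁺ : ∀ {a x} → x < a → kind a (suc x) ≡ clique
kind-clique⁺ {suc a} {zero} _ = refl
kind-clique⁺ {suc a} {suc x} x<a = kind-clique⁺ (s≤s⁻¹ x<a)

kind-leaf⁺ : ∀ {a x} → a ≤ x → kind a (suc x) ≡ leaf
kind-leaf⁺ {zero} _ = refl
kind-leaf⁺ {suc a} {suc x} a≤x = kind-leaf⁺ (s≤s⁻¹ a≤x)

kind-center⁻ : ∀ a x → kind a x ≡ center → x ≡ 0
kind-center⁻ a zero _ = refl
kind-center⁻ (suc a) (suc (suc x)) eq = contradiction (kind-center⁻ a (suc x) eq) λ ()

kind-nonleaf⁻ : ∀ a x → kind a x ≢ leaf → x ≤ a
kind-nonleaf⁻ a zero _ = z≤n
kind-nonleaf⁻ zero (suc x) ≢leaf = contradiction refl ≢leaf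
kind-nonleaf⁻ (suc a) (suc zero) _ = s≤s z≤n
kind-nonleaf⁻ (suc a) (suc (suc x)) ≢leaf = s≤s (kind-nonleaf⁻ a (suc x) ≢leaf)

-- Vertex 0 is adjacent to everything, 1, …, a induce a clique, and the remaining vertices are pendant.
Sparkler : (a s : ℕ) → Graph
Sparkler a s = record
  { size = s
  ; adj = edge
  ; sym = edge-sym
  ; irrefl = edge-irrefl
  }
  where
  edge : Fin s → Fin s → Bool
  edge u v = not (does (u Finₚ.≟ v)) ∧ joined (kind a (toℕ u)) (kind a (toℕ v))
  edge-sym : ∀ u v → edge u v ≡ edge v u
  edge-sym u v with u Finₚ.≟ v | v Finₚ.≟ u
  ... | yes _ | yes _ = refl
  ... | yes refl | no v≢u = contradiction refl v≢u
  ... | no u≢v | yes refl = contradiction refl u≢v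
  ... | no _ | no _ = joined-sym (kind a (toℕ u)) (kind a (toℕ v))
  edge-irrefl : ∀ u → edge u u ≡ false
  edge-irrefl u with u Finₚ.≟ u
  ... | yes _ = refl
  ... | no u≢u = contradiction refl u≢u

module _ {a s : ℕ} where

  private
    S = Sparkler a s
    κ : V S → Kind
    κ v = kind a (toℕ v)

  sparkler-~⁺ : ∀ {u v} → u ≢ v → joined (κ u) (κ v) ≡ true → S [ u ~ v ]
  sparkler-~⁺ {u} {v} u≢v eq with u Finₚ.≟ v
  ... | yes u≡v = contradiction u≡v u≢v
  ... | no _ = eq

  sparkler-~⁻ : ∀ {u v} → S [ u ~ v ] → joined (κ u) (κ v) ≡ true
  sparkler-~⁻ {u} {v} u~v with u Finₚ.≟ v
  ... | no _ = u~v

  κ-center-unique : ∀ {u v} → κ u ≡ center → κ v ≡ center → u ≡ v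
  κ-center-unique {u} {v} p q =
    Finₚ.toℕ-injective (trans (kind-center⁻ a (toℕ u) p) (≡.sym (kind-center⁻ a (toℕ v) q)))

  leaf-neighbour : ∀ {u v} → S [ u ~ v ] → κ u ≡ leaf → κ v ≡ center
  leaf-neighbour {u} {v} u~v eq = joined-leaf (κ v) (subst (λ t → joined t (κ v) ≡ true) eq (sparkler-~⁻ {u} u~v))
    where
    joined-leaf : ∀ κ′ → joined leaf κ′ ≡ true → κ′ ≡ center
    joined-leaf center _ = refl

hub : ∀ {s} → 1 ≤ s → Fin s
hub (s≤s _) = zero

κ-hub : ∀ a {s} (1≤s : 1 ≤ s) → kind a (toℕ (hub 1≤s)) ≡ center
κ-hub a (s≤s _) = refl

sparkler-connected : ∀ a {s} → Connected (Sparkler a s)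
sparkler-connected a {suc s} u v = toHub u (fromHub v)
  where
  S = Sparkler a (suc s)
  fromHub : ∀ v → Reach S zero v
  fromHub zero = here zero
  fromHub (suc v) = step zero (suc v) (suc v) refl (here (suc v))
  toHub : ∀ u {v} → Reach S zero v → Reach S u v
  toHub zero r = r
  toHub (suc u) {v} r = step (suc u) zero v (~-sym S {zero} {suc u} refl) r

-- The path runs from the pendant vertex `1 + a` to the center 0 and on through the clique vertices
-- `1, …, a`.
sparkler-contains : ∀ a {s} → 2 + a ≤ s → ContainsSubgraph (P (2 + a)) (Sparkler a s)
sparkler-contains a {s} big = e , e-injective , edges
  where
  S = Sparkler a s
  label : Fin (2 + a) → Fin (2 + a)
  label zero = Data.Fin.fromℕ (suc a)
  label (suc i) = Data.Fin.inject₁ i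
  label-injective : Injective _≡_ _≡_ label
  label-injective {zero} {zero} _ = refl
  label-injective {zero} {suc j} eq = contradiction eq Finₚ.fromℕ≢inject₁
  label-injective {suc i} {zero} eq = contradiction (≡.sym eq) Finₚ.fromℕ≢inject₁
  label-injective {suc i} {suc j} eq = cong suc (Finₚ.inject₁-injective eq)
  e : Fin (2 + a) → V S
  e i = Data.Fin.inject≤ (label i) big
  e-injective : Injective _≡_ _≡_ e
  e-injective = label-injective ∘ Finₚ.inject≤-injective big big _ _
  κ : Fin (2 + a) → Kind
  κ i = kind a (toℕ (e i))
  κ-suc : ∀ i → κ (suc i) ≡ kind a (toℕ i)
  κ-suc i = cong (kind a) (trans (Finₚ.toℕ-inject≤ _ big) (Finₚ.toℕ-inject₁ i))
  nonleaf : ∀ i → κ (suc (suc i)) ≡ clique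
  nonleaf i = trans (κ-suc (suc i)) (kind-clique⁺ (Finₚ.toℕ<n i))
  joined-center : ∀ κ → joined κ center ≡ true
  joined-center κ = joined-sym κ center
  joined-succ : ∀ i j → suc (toℕ i) ≡ toℕ j → joined (κ i) (κ j) ≡ true
  joined-succ zero (suc zero) _ rewrite κ-suc zero = joined-center (κ zero)
  joined-succ (suc zero) (suc (suc j)) _ rewrite κ-suc zero = refl
  joined-succ (suc (suc i)) (suc (suc j)) _ rewrite nonleaf i | nonleaf j = refl
  edge : ∀ i j → suc (toℕ i) ≡ toℕ j → S [ e i ~ e j ]
  edge i j eq = sparkler-~⁺ {a} (λ ei≡ej → ℕₚ.1+n≢n (trans eq (≡.sym (cong toℕ (e-injective ei≡ej)))))
                  (joined-succ i j eq)
  edges : ∀ i j → adj (P (2 + a)) i j ≡ true → S [ e i ~ e j ]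
  edges i j i~j with pathAdj⁻ i j i~j
  ... | inj₁ eq = edge i j eq
  ... | inj₂ eq = ~-sym S {e j} {e i} (edge j i eq)

-- Pendant vertices can only be the two ends of a path, and not both of them,
-- since then the second and the last but one vertex would coincide.
sparkler-avoids : ∀ m {s} → ¬ ContainsSubgraph (P (4 + m)) (Sparkler (suc m) s)
sparkler-avoids m {s} sub = contradiction-from (contains⇒path {Sparkler (suc m) s} sub)
  where
  S = Sparkler (suc m) s
  κ : V S → Kind
  κ v = kind (suc m) (toℕ v)
  -- Only the center and the `1 + m` clique vertices are not pendant.
  no-long-path : ∀ {h} → IsPath S (3 + m) h → (∀ i → i < 3 + m → κ (h i) ≢ leaf) → ⊥
  no-long-path {h} p nonleaf = contradiction (Finₚ.injective⇒≤ {f = e} e-injective) (ℕₚ.n≮n _)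
    where
    bound : (i : Fin (3 + m)) → toℕ (h (toℕ i)) < 2 + m
    bound i = s≤s (kind-nonleaf⁻ (suc m) _ (nonleaf (toℕ i) (Finₚ.toℕ<n i)))
    e : Fin (3 + m) → Fin (2 + m)
    e i = fromℕ< (bound i)
    e-injective : Injective _≡_ _≡_ e
    e-injective {i} {j} eq with toℕ i ≟ toℕ j
    ... | yes i≡j = Finₚ.toℕ-injective i≡j
    ... | no i≢j = contradiction
      (Finₚ.toℕ-injective (Finₚ.fromℕ<-injective _ _ (bound i) (bound j) eq))
      (distinct-≢ {S} p (Finₚ.toℕ<n i) (Finₚ.toℕ<n j) i≢j)
  -- Both path neighbours of a pendant inner vertex would be the center.
  interior : ∀ {h} → IsPath S (4 + m) h → ∀ i → 2 + i < 4 + m → κ (h (suc i)) ≢ leaf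
  interior {h} p i i<n isLeaf = distinct p i (2 + i) (ℕₚ.m<n+m i z<s) i<n (κ-center-unique {suc m}
    (leaf-neighbour {suc m} {s} {h (suc i)}
      (~-sym S {h i} {h (suc i)} (adjacent p i (ℕₚ.<-trans (ℕₚ.n<1+n _) i<n))) isLeaf)
    (leaf-neighbour {suc m} {s} {h (suc i)} (adjacent p (suc i) i<n) isLeaf))
  contradiction-from : ¬ ∃ (IsPath S (4 + m))
  contradiction-from (h , p) with κ (h 0) ≟ᵏ leaf | κ (h (3 + m)) ≟ᵏ leaf
  ... | yes first | yes last =
    distinct p 1 (2 + m) (s<s z<s) (s<s (s<s (ℕₚ.m<n+m m z<s))) (κ-center-unique {suc m}
      (leaf-neighbour {suc m} {s} {h 0} (adjacent p 0 (s<s z<s)) first)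
      (leaf-neighbour {suc m} {s} {h (3 + m)}
        (~-sym S {h (2 + m)} {h (3 + m)} (adjacent p (2 + m) ℕₚ.≤-refl)) last))
  ... | no first | _ = no-long-path (init-path {S} p) nonleaf
    where
    nonleaf : ∀ i → i < 3 + m → κ (h i) ≢ leaf
    nonleaf zero _ = first
    nonleaf (suc i) i<n = interior p i (s<s i<n)
  ... | yes _ | no last = no-long-path (tail-path {S} p) nonleaf
    where
    nonleaf : ∀ i → i < 3 + m → κ (h (suc i)) ≢ leaf
    nonleaf i i<n with i ≟ 2 + m
    ... | yes refl = last
    ... | no i≢ = interior p i (s<s (s<s (ℕₚ.≤∧≢⇒< (s≤s⁻¹ i<n) i≢)))

-- Positions of the pebble game

module _ {A B : Set} (R : A → A → B → B → Set) where

  -- Serves equality patterns and atomic types alike: a pair of variables involves the reassigned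
  -- `x` twice, once or not at all.
  extend-pairs : (∀ {u u′ w w′} → R u u′ w w′ → R u′ u w′ w) → ∀ {X f g v w} x → R v v w w →
    (∀ {y z} → y ∈ X → z ∈ X → R (f y) (f z) (g y) (g z)) →
    (∀ {y} → y ∈ X → R (f y) v (g y) w) →
    ∀ {y z} → y ∈ x ∷ X → z ∈ x ∷ X →
    R ((f [ x ≔ v ]) y) ((f [ x ≔ v ]) z) ((g [ x ≔ w ]) y) ((g [ x ≔ w ]) z)
  extend-pairs R-sym x diagonal old new {y} {z} y∈ z∈ with y ≟ x | z ≟ x
  ... | yes _ | yes _ = diagonal
  ... | yes _ | no z≢x = R-sym (new (Any.tail z≢x z∈))
  ... | no y≢x | yes _ = new (Any.tail y≢x y∈)
  ... | no y≢x | no z≢x = old (Any.tail y≢x y∈) (Any.tail z≢x z∈)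

SameEquality : {A B : Set} → A → A → B → B → Set
SameEquality u u′ w w′ = (u ≡ u′) ⇔ (w ≡ w′)

sameEquality-sym : ∀ {A B : Set} {u u′ : A} {w w′ : B} → SameEquality u u′ w w′ → SameEquality u′ u w′ w
sameEquality-sym e = mk⇔ (≡.sym ∘ to e ∘ ≡.sym) (≡.sym ∘ from e ∘ ≡.sym)

SameAtoms : (G H : Graph) → V G → V G → V H → V H → Set
SameAtoms G H u u′ w w′ = SameEquality u u′ w w′ × adj G u u′ ≡ adj H w w′

PartialIso : (G H : Graph) → List ℕ → (ℕ → V G) → (ℕ → V H) → Set
PartialIso G H X f g = ∀ {x y} → x ∈ X → y ∈ X → SameAtoms G H (f x) (f y) (g x) (g y)

partialIso-sym : ∀ {G H X f g} → PartialIso G H X f g → PartialIso H G X g f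
partialIso-sym iso x∈ y∈ = let e , a = iso x∈ y∈ in ⇔ₚ.sym e , ≡.sym a

partialIso-extend : ∀ G H {X f g v w} x → PartialIso G H X f g →
  (∀ {y} → y ∈ X → SameAtoms G H (f y) v (g y) w) →
  PartialIso G H (x ∷ X) (f [ x ≔ v ]) (g [ x ≔ w ])
partialIso-extend G H {v = v} {w} x iso new = extend-pairs (SameAtoms G H)
  (λ {u} {u′} {w} {w′} (e , a) → sameEquality-sym e , trans (sym G u′ u) (trans a (sym H w w′)))
  x (mk⇔ (λ _ → refl) (λ _ → refl) , trans (irrefl G v) (≡.sym (irrefl H w))) iso new

-- The invariant kept while further rounds are to come. Unlike a partial isomorphism it also fixes
-- the kinds of the pebbled vertices, which later moves could reveal.
record Similar (a b : ℕ) {s : ℕ} (X : List ℕ) (f g : ℕ → Fin s) : Set where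
  field
    kinds  : ∀ {x} → x ∈ X → kind b (toℕ (g x)) ≡ kind a (toℕ (f x))
    equals : ∀ {x y} → x ∈ X → y ∈ X → SameEquality (f x) (f y) (g x) (g y)
open Similar

module _ {a b s : ℕ} where

  similar-sym : ∀ {X f g} → Similar a b {s} X f g → Similar b a X g f
  similar-sym sim .kinds x∈ = ≡.sym (kinds sim x∈)
  similar-sym sim .equals x∈ y∈ = ⇔ₚ.sym (equals sim x∈ y∈)

  similar-⊆ : ∀ {X Y f g} → (∀ {x} → x ∈ Y → x ∈ X) → Similar a b {s} X f g → Similar a b Y f g
  similar-⊆ Y⊆X sim .kinds x∈ = kinds sim (Y⊆X x∈)
  similar-⊆ Y⊆X sim .equals x∈ y∈ = equals sim (Y⊆X x∈) (Y⊆X y∈)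

  similar-extend : ∀ {X f g v w} x → Similar a b {s} X f g → kind b (toℕ w) ≡ kind a (toℕ v) →
    (∀ {y} → y ∈ X → SameEquality (f y) v (g y) w) →
    Similar a b (x ∷ X) (f [ x ≔ v ]) (g [ x ≔ w ])
  similar-extend x sim κ≡ new .kinds {y} y∈ with y ≟ x
  ... | yes _ = κ≡
  ... | no y≢x = kinds sim (Any.tail y≢x y∈)
  similar-extend x sim κ≡ new .equals =
    extend-pairs SameEquality sameEquality-sym x (mk⇔ (λ _ → refl) (λ _ → refl)) (equals sim) new

  sameKinds⇒sameAtoms : ∀ {u u′ w w′ : Fin s} → kind b (toℕ w) ≡ kind a (toℕ u) → kind b (toℕ w′) ≡ kind a (toℕ u′) →
    SameEquality u u′ w w′ → SameAtoms (Sparkler a s) (Sparkler b s) u u′ w w′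
  sameKinds⇒sameAtoms {u} {u′} {w} {w′} κ≡ κ′≡ e =
    e , cong₂ _∧_ (cong not (does-⇔ e (u Finₚ.≟ u′) (w Finₚ.≟ w′))) (≡.sym (cong₂ joined κ≡ κ′≡))

  similar⇒partialIso : ∀ {X f g} → Similar a b {s} X f g → PartialIso (Sparkler a s) (Sparkler b s) X f g
  similar⇒partialIso sim x∈ y∈ = sameKinds⇒sameAtoms (kinds sim x∈) (kinds sim y∈) (equals sim x∈ y∈)

  answer : 1 ≤ s → ∀ {X f g} → Similar a b {s} X f g → ∀ v →
    (kind a (toℕ v) ≢ center → ∃ λ w → kind b (toℕ w) ≡ kind a (toℕ v) × w ∉ map g X) →
    ∃ λ w → kind b (toℕ w) ≡ kind a (toℕ v) × (∀ {y} → y ∈ X → SameEquality (f y) v (g y) w)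
  answer 1≤s {X} {f} {g} sim v unused with Any.any? (λ y → f y Finₚ.≟ v) X
  ... | yes repeated with z , z∈X , refl ← find repeated = g z , kinds sim z∈X , λ y∈ → equals sim y∈ z∈X
  ... | no new with kind a (toℕ v) ≟ᵏ center
  ...   | yes κv = hub 1≤s , trans (κ-hub b 1≤s) (≡.sym κv) , λ {y} y∈ → mk⇔
            (λ fy≡v → contradiction (lose y∈ fy≡v) new)
            (λ gy≡hub → κ-center-unique {a} (trans (≡.sym (kinds sim y∈))
              (trans (cong (kind b ∘ toℕ) gy≡hub) (κ-hub b 1≤s))) κv)
  ...   | no κv with w , κw , w∉ ← unused κv = w , κw , λ {y} y∈ → mk⇔
            (λ fy≡v → contradiction (lose y∈ fy≡v) new)
            (λ gy≡w → contradiction (subst (_∈ map g X) gy≡w (∈ₚ.∈-map⁺ g y∈)) w∉)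

-- Replies in the pebble game

freshClique : ∀ {b m s} → m ≤ b → b < s → ∀ (L : List (Fin s)) → length L < m →
              ∃ λ w → kind b (toℕ w) ≡ clique × w ∉ L
freshClique {b} {m} {s} m≤b b<s L L<m =
  let i , e∉ = fresh e e-injective L L<m in
    e i , trans (cong (kind b) (Finₚ.toℕ-fromℕ< (bound i))) (kind-clique⁺ (ℕₚ.<-≤-trans (Finₚ.toℕ<n i) m≤b)) , e∉
  where
  bound : (i : Fin m) → suc (toℕ i) < s
  bound i = ℕₚ.≤-<-trans (ℕₚ.<-≤-trans (Finₚ.toℕ<n i) m≤b) b<s
  e : Fin m → Fin s
  e i = fromℕ< (bound i)
  e-injective : Injective _≡_ _≡_ e
  e-injective {i} {j} eq =
    Finₚ.toℕ-injective (ℕₚ.suc-injective (Finₚ.fromℕ<-injective _ _ (bound i) (bound j) eq))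

freshLeaf : ∀ {b n s} → suc (b + n) ≤ s → ∀ (L : List (Fin s)) → length L < n →
            ∃ λ w → kind b (toℕ w) ≡ leaf × w ∉ L
freshLeaf {b} {n} {s} big L L<n =
  let i , e∉ = fresh e e-injective L L<n in
    e i , trans (cong (kind b) (Finₚ.toℕ-fromℕ< (bound i))) (kind-leaf⁺ (ℕₚ.m≤m+n b (toℕ i))) , e∉
  where
  bound : (i : Fin n) → suc (b + toℕ i) < s
  bound i = ℕₚ.<-≤-trans (s<s (ℕₚ.+-monoʳ-< b (Finₚ.toℕ<n i))) big
  e : Fin n → Fin s
  e i = fromℕ< (bound i)
  e-injective : Injective _≡_ _≡_ e
  e-injective {i} {j} eq = Finₚ.toℕ-injective (ℕₚ.+-cancelˡ-≡ b _ _
    (ℕₚ.suc-injective (Finₚ.fromℕ<-injective _ _ (bound i) (bound j) eq)))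

_∖_ : List ℕ → ℕ → List ℕ
X ∖ x = filter (λ y → ¬? (y ≟ x)) X

∖-length : ∀ {X x} → x ∈ X → length (X ∖ x) < length X
∖-length {X} {x} x∈ = Listₚ.filter-notAll (λ y → ¬? (y ≟ x)) X (lose x∈ (λ x≢x → x≢x refl))

-- The answering graph has at least `m` clique vertices and, by `big`, at least `1 + m` pendant
-- ones. Thus fewer than `m` pebbles exhaust neither kind, and `m` pebbles can only exhaust the
-- clique vertices.
module Moves (m : ℕ) {a b s : ℕ} (m≤b : m ≤ b) (big : suc (b + suc m) ≤ s) where

  private
    1≤s : 1 ≤ s
    1≤s = ℕₚ.≤-trans (s≤s z≤n) big
    b<s : b < s
    b<s = ℕₚ.≤-trans (s≤s (ℕₚ.m≤m+n b (suc m))) big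

  similar-forth : ∀ {X f g} x → length X < m → Similar a b {s} X f g → ∀ v →
                  ∃ λ w → Similar a b (x ∷ X) (f [ x ≔ v ]) (g [ x ≔ w ])
  similar-forth {X} {f} {g} x X<m sim v =
    let w , κw , new = answer 1≤s sim v (unused (kind a (toℕ v))) in w , similar-extend x sim κw new
    where
    g[X]<m : length (map g X) < m
    g[X]<m = subst (_< m) (≡.sym (Listₚ.length-map g X)) X<m
    unused : ∀ κ → κ ≢ center → ∃ λ w → kind b (toℕ w) ≡ κ × w ∉ map g X
    unused center κ≢ = contradiction refl κ≢
    unused clique _ = freshClique m≤b b<s (map g X) g[X]<m
    unused leaf _ = freshLeaf big (map g X) (ℕₚ.m<n⇒m<1+n g[X]<m)

  -- In the last round a clique vertex may also be answered by the center:
  -- as long as only clique vertices are in play, the center looks like one more of them.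
  partialIso-forth : ∀ {X f g} x → length X ≤ m → Similar a b {s} X f g → ∀ v →
                     ∃ λ w → PartialIso (Sparkler a s) (Sparkler b s) (x ∷ X) (f [ x ≔ v ]) (g [ x ≔ w ])
  partialIso-forth {X} {f} {g} x X≤m sim v = reply (kind a (toℕ v)) refl
    where
    G = Sparkler a s
    H = Sparkler b s
    Reply = ∃ λ w → PartialIso G H (x ∷ X) (f [ x ≔ v ]) (g [ x ≔ w ])

    byKind : (kind a (toℕ v) ≢ center → ∃ λ w → kind b (toℕ w) ≡ kind a (toℕ v) × w ∉ map g X) → Reply
    byKind unused with w , κw , new ← answer 1≤s sim v unused =
      w , similar⇒partialIso (similar-extend x sim κw new)

    byCenter : kind a (toℕ v) ≡ clique → (∀ {y} → y ∈ X → kind b (toℕ (g y)) ≡ clique) →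
               (∀ {y} → y ∈ X → f y ≢ v) → Reply
    byCenter κv allClique new = hub 1≤s , partialIso-extend G H x (similar⇒partialIso sim) λ {y} y∈ →
      let gy≢hub : g y ≢ hub 1≤s
          gy≢hub eq = contradiction (trans (≡.sym (κ-hub b 1≤s)) (trans (cong (kind b ∘ toℕ) (≡.sym eq)) (allClique y∈))) λ ()
      in mk⇔ (λ eq → contradiction eq (new y∈)) (λ eq → contradiction eq gy≢hub)
       , trans (sparkler-~⁺ {a} (new y∈) (cong₂ joined (trans (≡.sym (kinds sim y∈)) (allClique y∈)) κv))
               (≡.sym (sparkler-~⁺ {b} gy≢hub (cong₂ joined (allClique y∈) (κ-hub b 1≤s))))

    reply : ∀ κ → kind a (toℕ v) ≡ κ → Reply
    reply center κv = byKind λ κ≢ → contradiction κv κ≢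
    reply leaf κv = byKind λ _ →
      let w , κw , w∉ = freshLeaf big (map g X) (s≤s (ℕₚ.≤-trans (ℕₚ.≤-reflexive (Listₚ.length-map g X)) X≤m))
      in w , trans κw (≡.sym κv) , w∉
    reply clique κv with All.all? (λ y → kind b (toℕ (g y)) ≟ᵏ clique) X | Any.any? (λ y → f y Finₚ.≟ v) X
    ... | yes all | no new = byCenter κv (All.lookup all) (λ y∈ fy≡v → new (lose y∈ fy≡v))
    ... | _ | yes repeated with z , z∈X , refl ← find repeated =
      g z , partialIso-extend G H x (similar⇒partialIso sim) (λ y∈ → similar⇒partialIso sim y∈ z∈X)
    -- The pebble `z` is not on a clique vertex, so the others, fewer than `m`, leave a clique
    -- vertex free; its kind tells it apart from `g z`.
    ... | no notAll | no _ with z , z∈X , κz ← find (Allₚ.¬All⇒Any¬ (λ y → kind b (toℕ (g y)) ≟ᵏ clique) X notAll) =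
      byKind λ _ →
      let w , κw , w∉ = freshClique m≤b b<s (map g (X ∖ z)) (ℕₚ.<-≤-trans
            (subst (_< length X) (≡.sym (Listₚ.length-map g (X ∖ z))) (∖-length z∈X)) X≤m)
      in w , trans κw (≡.sym κv) , λ w∈ →
         let y , y∈X , w≡gy = ∈ₚ.∈-map⁻ g w∈
             y≢z : y ≢ z
             y≢z y≡z = κz (trans (cong (kind b ∘ toℕ ∘ g) (≡.sym y≡z)) (trans (cong (kind b ∘ toℕ) (≡.sym w≡gy)) κw))
         in w∉ (subst (_∈ map g (X ∖ z)) (≡.sym w≡gy)
              (∈ₚ.∈-map⁺ g (∈ₚ.∈-filter⁺ (λ y → ¬? (y ≟ z)) y∈X y≢z)))

-- The lower bounds

module LowerBounds (m : ℕ) (Φ : Formula) (defines : DefinesAsympConn Φ (P (4 + m))) where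
  N s : ℕ
  N = proj₁ (proj₂ defines)
  -- `N` brings the graphs under the criterion for `Φ`. The path needs `4 + m` vertices, and
  -- `5 + 2m` vertices leave `2 + m` pendant ones even in `G`.
  s = N + (4 + m + (4 + m))
  G = Sparkler (2 + m) s
  H = Sparkler (1 + m) s

  bigG : suc ((2 + m) + (2 + m)) ≤ s
  bigG = ℕₚ.≤-trans (ℕₚ.+-mono-≤ (ℕₚ.m≤n+m (3 + m) 1) (ℕₚ.m≤n+m (2 + m) 2)) (ℕₚ.m≤n+m _ N)
  bigH : suc ((1 + m) + (2 + m)) ≤ s
  bigH = ℕₚ.≤-trans (ℕₚ.n≤1+n _) bigG

  module Forth = Moves (1 + m) {2 + m} {1 + m} {s} ℕₚ.≤-refl bigH
  module Back = Moves (1 + m) {1 + m} {2 + m} {s} (ℕₚ.n≤1+n _) bigG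

  1≤s : 1 ≤ s
  1≤s = ℕₚ.≤-trans (s≤s z≤n) bigG

  f₀ : ℕ → Fin s
  f₀ _ = hub 1≤s

  distinguished : ¬ (Sat G Φ f₀ ⇔ Sat H Φ f₀)
  distinguished e = sparkler-avoids m {s} (to (criterion (1 + m))
      (from (⊨⇔sat H Φ closed f₀) (to e (to (⊨⇔sat G Φ closed f₀)
      (from (criterion (2 + m)) (sparkler-contains (2 + m)
        (ℕₚ.≤-trans (ℕₚ.m≤m+n (4 + m) (4 + m)) (ℕₚ.m≤n+m _ N))))))))
    where
    closed = proj₁ defines
    criterion : ∀ a → (Sparkler a s ⊨ Φ) ⇔ ContainsSubgraph (P (4 + m)) (Sparkler a s)
    criterion a = proj₂ (proj₂ defines) (Sparkler a s) (sparkler-connected a) (ℕₚ.m≤m+n N _)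

  ∖-cover : ∀ {X x y} → y ∈ X → y ∈ x ∷ (X ∖ x)
  ∖-cover {X} {x} {y} y∈ with y ≟ x
  ... | yes y≡x = Any.here y≡x
  ... | no y≢x = Any.there (∈ₚ.∈-filter⁺ (λ y → ¬? (y ≟ x)) y∈ y≢x)

  -- `X` holds all variables of the formula. Quantifying `x` first lifts its pebble, so at most `m`
  -- pebbles lie on the graph when the reply is chosen, and kinds can be kept forever.
  widthGame : (X : List ℕ) → length X ≤ 1 + m → BackAndForth G H
  widthGame X X≤m = record
    { Pos = λ φ f g → (∀ {x} → x ∈ vars φ → x ∈ X) × Similar (2 + m) (1 + m) X f g
    ; pos-~ = λ (v , sim) → proj₂ (similar⇒partialIso sim (v (Any.here refl)) (v (Any.there (Any.here refl))))
    ; pos-= = λ (v , sim) → equals sim (v (Any.here refl)) (v (Any.there (Any.here refl)))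
    ; pos-¬ = id
    ; pos-∧ = λ {φ} (v , sim) → (v ∘ ∈ₚ.∈-++⁺ˡ , sim) , (v ∘ ∈ₚ.∈-++⁺ʳ (vars φ) , sim)
    ; pos-∨ = λ {φ} (v , sim) → (v ∘ ∈ₚ.∈-++⁺ˡ , sim) , (v ∘ ∈ₚ.∈-++⁺ʳ (vars φ) , sim)
    ; pos-∀ = id
    ; forth = λ {x} (v , sim) u →
        let w , sim′ = Forth.similar-forth x (room (v (Any.here refl))) (similar-⊆ ∖-⊆ sim) u
        in w , v ∘ Any.there , similar-⊆ ∖-cover sim′
    ; back = λ {x} (v , sim) w →
        let u , sim′ = Back.similar-forth x (room (v (Any.here refl))) (similar-⊆ ∖-⊆ (similar-sym sim)) w
        in u , v ∘ Any.there , similar-⊆ ∖-cover (similar-sym sim′)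
    }
    where
    room : ∀ {x} → x ∈ X → length (X ∖ x) < 1 + m
    room x∈ = ℕₚ.<-≤-trans (∖-length x∈) X≤m
    ∖-⊆ : ∀ {x y} → y ∈ X ∖ x → y ∈ X
    ∖-⊆ {x} = proj₁ ∘ ∈ₚ.∈-filter⁻ (λ y → ¬? (y ≟ x))

  width-bound : 2 + m ≤ width Φ
  width-bound = ℕₚ.≰⇒> λ small → distinguished
    (BackAndForth.transfer (widthGame (deduplicate _≟_ (vars Φ)) small) Φ
      -- All pebbles start on the centers, hence in similar positions.
      (∈ₚ.∈-deduplicate⁺ _≟_ , record
        { kinds = λ _ → trans (κ-hub (1 + m) 1≤s) (≡.sym (κ-hub (2 + m) 1≤s))
        ; equals = λ _ _ → mk⇔ (λ _ → refl) (λ _ → refl) }))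

  -- The pebbles placed and the `suc r` rounds to come number at most `2 + m`. Only the very last
  -- reply may give up the kinds.
  Rounds : ℕ → List ℕ → (ℕ → V G) → (ℕ → V H) → Set
  Rounds zero X f g = PartialIso G H X f g
  Rounds (suc r) X f g = length X + r ≤ 1 + m × Similar (2 + m) (1 + m) X f g

  rounds⇒iso : ∀ r {X f g} → Rounds r X f g → PartialIso G H X f g
  rounds⇒iso zero iso = iso
  rounds⇒iso (suc r) (_ , sim) = similar⇒partialIso sim

  rounds-forth : ∀ r {X f g} x → Rounds (suc r) X f g → ∀ v →
                 ∃ λ w → Rounds r (x ∷ X) (f [ x ≔ v ]) (g [ x ≔ w ])
  rounds-forth zero x (room , sim) = Forth.partialIso-forth x (ℕₚ.m+n≤o⇒m≤o _ room) sim
  rounds-forth (suc r) {X} x (room , sim) v =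
    let room′ = subst (_≤ 1 + m) (ℕₚ.+-suc (length X) r) room
        w , sim′ = Forth.similar-forth x (ℕₚ.m+n≤o⇒m≤o _ room′) sim v
    in w , room′ , sim′

  rounds-back : ∀ r {X f g} x → Rounds (suc r) X f g → ∀ w →
                ∃ λ v → Rounds r (x ∷ X) (f [ x ≔ v ]) (g [ x ≔ w ])
  rounds-back zero x (room , sim) w =
    let v , iso = Back.partialIso-forth x (ℕₚ.m+n≤o⇒m≤o _ room) (similar-sym sim) w
    in v , partialIso-sym {H} {G} iso
  rounds-back (suc r) {X} x (room , sim) w =
    let room′ = subst (_≤ 1 + m) (ℕₚ.+-suc (length X) r) room
        v , sim′ = Back.similar-forth x (ℕₚ.m+n≤o⇒m≤o _ room′) (similar-sym sim) w
    in v , room′ , similar-sym sim′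

  depthGame : BackAndForth G H
  depthGame = record
    { Pos = Pos
    ; pos-~ = λ (X , r , d , v , p) → proj₂ (rounds⇒iso r p (v (Any.here refl)) (v (Any.there (Any.here refl))))
    ; pos-= = λ (X , r , d , v , p) → proj₁ (rounds⇒iso r p (v (Any.here refl)) (v (Any.there (Any.here refl))))
    ; pos-¬ = id
    ; pos-∧ = λ {φ} {ψ} → both φ ψ
    ; pos-∨ = λ {φ} {ψ} → both φ ψ
    ; pos-∀ = id
    ; forth = λ { {x} {φ} (X , suc r , d , v , p) u →
        let w , q = rounds-forth r x p u in w , x ∷ X , r , s≤s⁻¹ d , live x φ v , q }
    ; back = λ { {x} {φ} (X , suc r , d , v , p) w →
        let u , q = rounds-back r x p w in u , x ∷ X , r , s≤s⁻¹ d , live x φ v , q }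
    }
    where
    -- `X` gains an entry in each round, even when a variable is quantified again, so its length
    -- counts the rounds played.
    Pos : Formula → (ℕ → V G) → (ℕ → V H) → Set
    Pos φ f g = ∃₂ λ X r → depth φ ≤ r × (∀ {x} → x ∈ fv φ → x ∈ X) × Rounds r X f g
    both : ∀ φ ψ {f g} → Pos (φ ∧' ψ) f g → Pos φ f g × Pos ψ f g
    both φ ψ (X , r , d , v , p) =
        (X , r , ℕₚ.m⊔n≤o⇒m≤o _ _ d , v ∘ ∈ₚ.∈-++⁺ˡ , p)
      , (X , r , ℕₚ.m⊔n≤o⇒n≤o (depth φ) _ d , v ∘ ∈ₚ.∈-++⁺ʳ (fv φ) , p)
    live : ∀ x φ {X} → (∀ {y} → y ∈ fv (∃' x φ) → y ∈ X) → ∀ {y} → y ∈ fv φ → y ∈ x ∷ X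
    live x φ v {y} y∈ with y ≟ x
    ... | yes y≡x = Any.here y≡x
    ... | no y≢x = Any.there (v (bound-fv x φ y∈ y≢x))

  depth-bound : 3 + m ≤ depth Φ
  depth-bound = ℕₚ.≰⇒> λ small → distinguished (BackAndForth.transfer depthGame Φ
    ([] , depth Φ , ℕₚ.≤-refl , (λ x∈ → subst (_ ∈_) (proj₁ defines) x∈) , start (depth Φ) small))
    where
    start : ∀ r → r ≤ 2 + m → Rounds r [] f₀ f₀
    start zero _ ()
    start (suc r) r≤ = s≤s⁻¹ r≤ , record { kinds = λ () ; equals = λ () }

-- Finite conjunctions and blocks of quantifiers

-- Truth and falsity must be spelled out with some variable; 0 lies below every positive bound on
-- the variables.
⋀ ⋁ : List ℕ → (ℕ → Formula) → Formula
⋀ [] F = 0 =' 0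
⋀ (i ∷ is) F = F i ∧' ⋀ is F
⋁ [] F = ¬' (0 =' 0)
⋁ (i ∷ is) F = F i ∨' ⋁ is F

module _ {G : Graph} {F : ℕ → Formula} {f : ℕ → V G} where

  ⋀⁺ : ∀ is → (∀ {i} → i ∈ is → Sat G (F i) f) → Sat G (⋀ is F) f
  ⋀⁺ [] _ = refl
  ⋀⁺ (i ∷ is) sat = sat (Any.here refl) , ⋀⁺ is (sat ∘ Any.there)

  ⋀⁻ : ∀ is → Sat G (⋀ is F) f → ∀ {i} → i ∈ is → Sat G (F i) f
  ⋀⁻ (_ ∷ is) (p , _) (Any.here refl) = p
  ⋀⁻ (_ ∷ is) (_ , q) (Any.there i∈) = ⋀⁻ is q i∈

  ⋁⁺ : ∀ {is i} → i ∈ is → Sat G (F i) f → Sat G (⋁ is F) f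
  ⋁⁺ (Any.here refl) sat = inj₁ sat
  ⋁⁺ (Any.there i∈) sat = inj₂ (⋁⁺ i∈ sat)

  ⋁⁻ : ∀ is → Sat G (⋁ is F) f → ∃ λ i → i ∈ is × Sat G (F i) f
  ⋁⁻ [] absurd = contradiction refl absurd
  ⋁⁻ (i ∷ is) (inj₁ sat) = i , Any.here refl , sat
  ⋁⁻ (i ∷ is) (inj₂ rest) with j , j∈ , sat ← ⋁⁻ is rest = j , Any.there j∈ , sat

VarsBelow : ℕ → Formula → Set
VarsBelow k φ = All (_< k) (vars φ)

module _ {k : ℕ} (0<k : 0 < k) where

  ⋀-below : ∀ is F → (∀ {i} → i ∈ is → VarsBelow k (F i)) → VarsBelow k (⋀ is F)
  ⋀-below [] F _ = 0<k ∷ 0<k ∷ []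
  ⋀-below (i ∷ is) F below = Allₚ.++⁺ (below (Any.here refl)) (⋀-below is F (below ∘ Any.there))

  ⋁-below : ∀ is F → (∀ {i} → i ∈ is → VarsBelow k (F i)) → VarsBelow k (⋁ is F)
  ⋁-below [] F _ = 0<k ∷ 0<k ∷ []
  ⋁-below (i ∷ is) F below = Allₚ.++⁺ (below (Any.here refl)) (⋁-below is F (below ∘ Any.there))

⋀-depth : ∀ {d} is F → (∀ i → depth (F i) ≤ d) → depth (⋀ is F) ≤ d
⋀-depth [] F _ = z≤n
⋀-depth (i ∷ is) F shallow = ℕₚ.⊔-lub (shallow i) (⋀-depth is F shallow)

-- Binds the variables `0, …, k - 1`, with 0 outermost.
∃s : ℕ → Formula → Formula
∃s zero φ = φ
∃s (suc k) φ = ∃s k (∃' k φ)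

∃s-depth : ∀ k φ → depth (∃s k φ) ≡ k + depth φ
∃s-depth zero φ = refl
∃s-depth (suc k) φ = trans (∃s-depth k (∃' k φ)) (ℕₚ.+-suc k (depth φ))

∃s-below : ∀ {K} k φ → k ≤ K → VarsBelow K φ → VarsBelow K (∃s k φ)
∃s-below zero φ _ below = below
∃s-below (suc k) φ k<K below = ∃s-below k (∃' k φ) (ℕₚ.<⇒≤ k<K) (k<K ∷ below)

fv-below : ∀ {k} φ → VarsBelow k φ → All (_< k) (fv φ)
fv-below (x ~' y) below = below
fv-below (x =' y) below = below
fv-below (¬' φ) below = fv-below φ below
fv-below (φ ∧' ψ) below = Allₚ.++⁺ (fv-below φ (Allₚ.++⁻ˡ (vars φ) below)) (fv-below ψ (Allₚ.++⁻ʳ (vars φ) below))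
fv-below (φ ∨' ψ) below = Allₚ.++⁺ (fv-below φ (Allₚ.++⁻ˡ (vars φ) below)) (fv-below ψ (Allₚ.++⁻ʳ (vars φ) below))
fv-below (∃' x φ) (_ ∷ below) = Allₚ.filter⁺ (λ y → ¬? (y ≟ x)) (fv-below φ below)
fv-below (∀' x φ) (_ ∷ below) = Allₚ.filter⁺ (λ y → ¬? (y ≟ x)) (fv-below φ below)

∃-fv-below : ∀ {k} φ → All (_< suc k) (fv φ) → All (_< k) (fv (∃' k φ))
∃-fv-below {k} φ below = All.tabulate λ y∈ →
  let y∈φ , y≢k = ∈ₚ.∈-filter⁻ (λ y → ¬? (y ≟ k)) {xs = fv φ} y∈
  in ℕₚ.≤∧≢⇒< (s≤s⁻¹ (All.lookup below y∈φ)) y≢k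

∃s-sentence : ∀ k φ → All (_< k) (fv φ) → Sentence (∃s k φ)
∃s-sentence zero φ below with fv φ | below
... | [] | _ = refl
... | _ ∷ _ | () ∷ _
∃s-sentence (suc k) φ below = ∃s-sentence k (∃' k φ) (∃-fv-below φ below)

∃s⁻ : ∀ {G} k φ {f} → Sat G (∃s k φ) f → ∃ (Sat G φ)
∃s⁻ zero φ sat = _ , sat
∃s⁻ (suc k) φ sat with _ , v , sat′ ← ∃s⁻ k (∃' k φ) sat = _ , sat′

∃s⁺ : ∀ {G} k φ {f} → Sat G φ f → Sat G (∃s k φ) f
∃s⁺ zero φ sat = sat
∃s⁺ {G} (suc k) φ {f} sat = ∃s⁺ k (∃' k φ) (f k , sat-cong G φ (≔-id k) sat)

width-below : ∀ {k} Φ → VarsBelow k Φ → width Φ ≤ k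
width-below Φ below = unique-bounded-length (DecUniqueₚ.deduplicate-! _≟_ (vars Φ))
  (All.tabulate (All.lookup below ∘ ∈ₚ.∈-deduplicate⁻ _≟_ (vars Φ)))

-- The common frame of the upper bounds; the threshold is the number of vertices of the path itself.
∃s-defines : ∀ n k φ → All (_< k) (fv φ) →
  (∀ {G f} → Connected G → suc n ≤ size G → Sat G φ f → HasPath G (suc n)) →
  (∀ {G h} → Connected G → suc n ≤ size G → IsPath G (suc n) h → ∃ (Sat G φ)) →
  DefinesAsympConn (∃s k φ) (P (suc n))
∃s-defines n k φ below sound complete = closed , suc n , λ G conn big → mk⇔
  (λ holds → let f , sat = ∃s⁻ k φ (to (⊨⇔sat G Φ closed (λ _ → hub (ℕₚ.≤-trans (s≤s z≤n) big))) holds)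
             in hasPath⇒contains (sound {G} conn big sat))
  (λ sub → let h , path = contains⇒path {G} sub
               f , sat = complete {G} conn big path
           in from (⊨⇔sat G Φ closed f) (∃s⁺ k φ sat))
  where
  Φ = ∃s k φ
  closed = ∃s-sentence k φ below

-- Paths and their outside neighbours

avoids : ℕ → List ℕ → Formula
avoids x is = ⋀ is (λ i → ¬' (x =' i))

avoids-below : ∀ {k x} is → 0 < k → x < k → (∀ {i} → i ∈ is → i < k) → VarsBelow k (avoids x is)
avoids-below {x = x} is 0<k x<k is<k = ⋀-below 0<k is _ λ i∈ → x<k ∷ is<k i∈ ∷ []

avoids-depth : ∀ x is → depth (avoids x is) ≤ 0
avoids-depth x is = ⋀-depth is (λ i → ¬' (x =' i)) λ _ → z≤n

-- The path has `suc n` vertices, held by the variables `0, …, n`, and `n` edges.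
isPath : ℕ → Formula
isPath n = ⋀ (upTo n) (λ i → i ~' suc i) ∧' ⋀ (upTo (suc n)) (λ j → avoids j (upTo j))

isPath⁺ : ∀ {G n f} → IsPath G (suc n) f → Sat G (isPath n) f
isPath⁺ {G} {n} p =
    ⋀⁺ (upTo n) (λ {i} i∈ → adjacent p i (s<s (∈ₚ.∈-upTo⁻ i∈)))
  , ⋀⁺ {G} {λ j → avoids j (upTo j)} (upTo (suc n)) (λ {j} j∈ → ⋀⁺ {G} (upTo j)
      (λ {i} i∈ → distinct p i j (∈ₚ.∈-upTo⁻ i∈) (∈ₚ.∈-upTo⁻ j∈) ∘ ≡.sym))

isPath⁻ : ∀ {G n f} → Sat G (isPath n) f → IsPath G (suc n) f
isPath⁻ {n = n} (adjs , _) .adjacent i i<n = ⋀⁻ (upTo n) adjs (∈ₚ.∈-upTo⁺ (s≤s⁻¹ i<n))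
isPath⁻ {n = n} (_ , dists) .distinct i j i<j j<n =
  ⋀⁻ (upTo j) (⋀⁻ (upTo (suc n)) dists (∈ₚ.∈-upTo⁺ j<n)) (∈ₚ.∈-upTo⁺ i<j) ∘ ≡.sym

isPath-below : ∀ n → VarsBelow (suc n) (isPath n)
isPath-below n = Allₚ.++⁺
  (⋀-below z<s (upTo n) (λ i → i ~' suc i) λ i∈ →
    let i<n = ∈ₚ.∈-upTo⁻ i∈ in ℕₚ.m<n⇒m<1+n i<n ∷ s<s i<n ∷ [])
  (⋀-below z<s (upTo (suc n)) (λ j → avoids j (upTo j)) λ {j} j∈ →
    let j<n = ∈ₚ.∈-upTo⁻ j∈
    in avoids-below (upTo j) z<s j<n λ i∈ → ℕₚ.<-trans (∈ₚ.∈-upTo⁻ i∈) j<n)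

isPath-depth : ∀ n → depth (isPath n) ≤ 0
isPath-depth n = ℕₚ.⊔-lub (⋀-depth (upTo n) (λ i → i ~' suc i) λ _ → z≤n)
  (⋀-depth (upTo (suc n)) (λ j → avoids j (upTo j)) λ j → avoids-depth j (upTo j))

HasOutside : (G : Graph) → ℕ → (ℕ → V G) → ℕ → Set
HasOutside G k f e = ∃ λ y → G [ y ~ f e ] × (∀ i → i < k → y ≢ f i)

module _ {G : Graph} where

  outside⇒∉ : ∀ {k} {f : ℕ → V G} {y} → (∀ i → i < k → y ≢ f i) → y ∉ applyUpTo f k
  outside⇒∉ {f = f} y≢ y∈ with i , i<k , y≡fi ← ∈ₚ.∈-applyUpTo⁻ f y∈ = y≢ i i<k y≡fi

  outsideEnds⇒path : Connected G → ∀ {n f} → 3 + n ≤ size G → IsPath G (suc n) f →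
    HasOutside G (suc n) f 0 → HasOutside G (suc n) f n → HasPath G (3 + n)
  outsideEnds⇒path conn {n} {f} big p (y , y~ , y≢) (z , z~ , z≢) =
    subst (HasPath G) (cong (2 +_) len) (extendBothEnds conn
      (subst (λ k → 2 + k ≤ size G) (≡.sym len) big)
      (path-walk p) (path-unique p) (outside⇒∉ {suc n} {f} y≢) y~ (outside⇒∉ {suc n} {f} z≢) (~-sym G z~))
    where
    len : length (applyUpTo f (suc n)) ≡ suc n
    len = Listₚ.length-applyUpTo f (suc n)

  -- For completeness of the sentences, the two ends of a path on `3 + n` vertices are removed and
  -- become the outside neighbours of what is left.
  innerPath : ∀ {n h} → IsPath G (3 + n) h → IsPath G (suc n) (h ∘ suc)
  innerPath p = init-path (tail-path p)

  firstOutside : ∀ {n h} → IsPath G (3 + n) h → HasOutside G (suc n) (h ∘ suc) 0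
  firstOutside {n} {h} p = h 0 , adjacent p 0 (s<s z<s)
    , λ i i<k → distinct p 0 (suc i) z<s (s<s (ℕₚ.m<n⇒m<1+n i<k))

  lastOutside : ∀ {n h} → IsPath G (3 + n) h → HasOutside G (suc n) (h ∘ suc) n
  lastOutside {n} {h} p = h (2 + n) , ~-sym G (adjacent p (suc n) ℕₚ.≤-refl)
    , λ i i<k → distinct p (suc i) (2 + n) (s<s i<k) ℕₚ.≤-refl ∘ ≡.sym

-- The sentence of optimal depth

module ShallowSentence (n : ℕ) where

  k : ℕ
  k = suc n

  -- The path occupies the variables below `k`. The variable `k` serves both ends in separate
  -- subformulas, so the two outside neighbours cost a single level of depth.
  neighbourOutside hasOutside : ℕ → Formula
  neighbourOutside e = (k ~' e) ∧' avoids k (upTo k)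
  hasOutside e = ∃' k (neighbourOutside e)

  hasOutside⇔ : ∀ {G f e} → e < k → Sat G (hasOutside e) f ⇔ HasOutside G k f e
  hasOutside⇔ {G} {f} {e} e<k = mk⇔
    (λ (y , y~e , y≢) → y , ≡.subst₂ (G [_~_]) (≔-same k) (≔-other (ℕₚ.<⇒≢ e<k)) y~e
      , λ i i<k y≡fi → ⋀⁻ (upTo k) y≢ (∈ₚ.∈-upTo⁺ i<k) (trans (≔-same k) (trans y≡fi (≡.sym (≔-other (ℕₚ.<⇒≢ i<k))))))
    (λ (y , y~e , y≢) → y , ≡.subst₂ (G [_~_]) (≡.sym (≔-same k)) (≡.sym (≔-other (ℕₚ.<⇒≢ e<k))) y~e
      , ⋀⁺ (upTo k) λ {i} i∈ eq → let i<k = ∈ₚ.∈-upTo⁻ i∈ in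
          y≢ i i<k (trans (≡.sym (≔-same k)) (trans eq (≔-other (ℕₚ.<⇒≢ i<k)))))

  outside-below : ∀ {e} → e < k → VarsBelow (suc k) (neighbourOutside e)
  outside-below e<k = ℕₚ.n<1+n k ∷ ℕₚ.m<n⇒m<1+n e<k ∷
    avoids-below (upTo k) z<s (ℕₚ.n<1+n k) λ i∈ → ℕₚ.m<n⇒m<1+n (∈ₚ.∈-upTo⁻ i∈)

  body : Formula
  body = isPath n ∧' (hasOutside 0 ∧' hasOutside n)

  shallow : Formula
  shallow = ∃s k body

  shallow-defines : DefinesAsympConn shallow (P (3 + n))
  shallow-defines = ∃s-defines (2 + n) k body
    (Allₚ.++⁺ (fv-below (isPath n) (isPath-below n)) (Allₚ.++⁺
      (∃-fv-below (neighbourOutside 0) (fv-below (neighbourOutside 0) (outside-below z<s)))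
      (∃-fv-below (neighbourOutside n) (fv-below (neighbourOutside n) (outside-below (ℕₚ.n<1+n n))))))
    (λ {G} conn big (path , first , last) → outsideEnds⇒path {G} conn big (isPath⁻ {G} path)
      (to (hasOutside⇔ {G} z<s) first) (to (hasOutside⇔ {G} (ℕₚ.n<1+n n)) last))
    (λ {G} {h} conn big p → h ∘ suc , isPath⁺ {G} (innerPath {G} p)
      , from (hasOutside⇔ {G} z<s) (firstOutside {G} p) , from (hasOutside⇔ {G} (ℕₚ.n<1+n n)) (lastOutside {G} p))

  shallow-depth : depth shallow ≤ 2 + n
  shallow-depth = ℕₚ.≤-trans (ℕₚ.≤-reflexive (∃s-depth k body))
    (ℕₚ.≤-trans (ℕₚ.+-monoʳ-≤ k (ℕₚ.⊔-lub (ℕₚ.≤-trans (isPath-depth n) z≤n)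
      (ℕₚ.⊔-lub (s≤s (avoids-depth k (upTo k))) (s≤s (avoids-depth k (upTo k)))))) (ℕₚ.≤-reflexive (ℕₚ.+-comm k 1)))

-- The sentence of optimal width

Near : (G : Graph) → V G → V G → Set
Near G u v = v ≡ u ⊎ G [ v ~ u ]

near? : ∀ G u → Decidable (Near G u)
near? G u v = (v Finₚ.≟ u) ⊎-dec (adj G v u Boolₚ.≟ true)

-- For a neighbour `w` of `u`: `w` has a neighbour at distance 2 from `u`.
Exposed : (G : Graph) → V G → V G → Set
Exposed G u w = ∃ λ z → G [ z ~ w ] × ¬ Near G u z

-- The bound variable `z` is a parameter so that a path variable other than `e` can be re-used for
-- it.
dominates : ℕ → ℕ → Formula
dominates z e = ∀' z ((z =' e) ∨' (z ~' e))

dominates⇔ : ∀ {G f z e} → z ≢ e → Sat G (dominates z e) f ⇔ (∀ v → Near G (f e) v)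
dominates⇔ {G} {f} {z} {e} z≢e = ∀-⇔ (λ v → v , near v) (λ v → v , near v)
  where
  near : ∀ v → Sat G ((z =' e) ∨' (z ~' e)) (f [ z ≔ v ]) ⇔ Near G (f e) v
  near v rewrite ≔-same {f = f} z {v} | ≔-other {f = f} {z} {v} (z≢e ∘ ≡.sym) = ⇔ₚ.refl

module _ {G : Graph} (conn : Connected G) where

  -- Some edge leaves the closed neighbourhood of `u`, and its inner end cannot be `u` itself.
  exposedNeighbour : ∀ {u} → ¬ (∀ v → Near G u v) → ∃ λ c → G [ c ~ u ] × Exposed G u c
  exposedNeighbour {u} ¬dom
    with t , t-far ← Finₚ.¬∀⟶∃¬ _ (Near G u) (near? G u) ¬dom
    with boundaryEdge (near? G u) (conn u t) (inj₁ refl) t-far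
  ... | c , d , inj₁ refl , d-far , c~d = contradiction (inj₂ (~-sym G c~d)) d-far
  ... | c , d , inj₂ c~u , d-far , c~d = c , c~u , d , ~-sym G c~d , d-far

-- Three variables always include one to overwrite in a formula about `e` and `j`. Paths on 3 and 4
-- vertices allow fewer variables and are treated separately.
third : ∀ e j → ∃ λ z → z < 3 × z ≢ e × z ≢ j
third zero zero = 1 , s<s z<s , (λ ()) , (λ ())
third zero (suc zero) = 2 , s<s (s<s z<s) , (λ ()) , (λ ())
third zero (suc (suc j)) = 1 , s<s z<s , (λ ()) , (λ ())
third (suc e) (suc j) = 0 , z<s , (λ ()) , (λ ())
third (suc zero) zero = 2 , s<s (s<s z<s) , (λ ()) , (λ ())
third (suc (suc e)) zero = 1 , s<s z<s , (λ ()) , (λ ())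

module NarrowSentence (m : ℕ) where

  n k : ℕ
  n = 2 + m
  k = suc n

  others : ℕ → List ℕ
  others j = upTo k ∖ j

  others⁺ : ∀ {i j} → i < k → i ≢ j → i ∈ others j
  others⁺ {j = j} i<k i≢j = ∈ₚ.∈-filter⁺ (λ y → ¬? (y ≟ j)) (∈ₚ.∈-upTo⁺ i<k) i≢j

  others⁻ : ∀ {i j} → i ∈ others j → i < k × i ≢ j
  others⁻ {j = j} i∈ = let i∈k , i≢j = ∈ₚ.∈-filter⁻ (λ y → ¬? (y ≟ j)) {xs = upTo k} i∈ in ∈ₚ.∈-upTo⁻ i∈k , i≢j

  exposed : ℕ → ℕ → Formula
  exposed e j = let z = proj₁ (third e j) in ∃' z ((z ~' j) ∧' (¬' ((z =' e) ∨' (z ~' e))))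

  exposed⇔ : ∀ G f e j → Sat G (exposed e j) f ⇔ Exposed G (f e) (f j)
  exposed⇔ G f e j with z , _ , z≢e , z≢j ← third e j = ∃-⇔ (λ v → v , far v) (λ v → v , far v)
    where
    far : ∀ v → Sat G ((z ~' j) ∧' (¬' ((z =' e) ∨' (z ~' e)))) (f [ z ≔ v ]) ⇔ (G [ v ~ f j ] × ¬ Near G (f e) v)
    far v rewrite ≔-same {f = f} z {v} | ≔-other {f = f} {z} {v} (z≢e ∘ ≡.sym)
                | ≔-other {f = f} {z} {v} (z≢j ∘ ≡.sym) = ⇔ₚ.refl

  -- Re-using the variable j for an outside neighbour y of e is safe as soon as
  -- some property θ holds for y but not for the old value of j.
  swap : ℕ → ℕ → Formula → Formula
  swap e j θ = (¬' θ) ∧' ∃' j ((j ~' e) ∧' (avoids j (others j) ∧' θ))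

  module _ (G : Graph) (e j : ℕ) (θ : Formula) (T : V G → V G → Set)
           (θ⇔ : ∀ f → Sat G θ f ⇔ T (f e) (f j)) (j≢e : j ≢ e) where

    swap⁻ : ∀ {f} → e < k → Sat G (swap e j θ) f → HasOutside G k f e
    swap⁻ {f} e<k (¬θ , y , y~e , y≢ , θy) = y , ≡.subst₂ (G [_~_]) (≔-same j) (≔-other (j≢e ∘ ≡.sym)) y~e , outside
      where
      outside : ∀ i → i < k → y ≢ f i
      outside i i<k y≡fi with i ≟ j
      ... | yes refl = ¬θ (from (θ⇔ f) (≡.subst₂ T (≔-other (j≢e ∘ ≡.sym)) (trans (≔-same j) y≡fi) (to (θ⇔ _) θy)))
      ... | no i≢j = ⋀⁻ {G} {λ i → ¬' (j =' i)} (others j) y≢ (others⁺ i<k i≢j) (trans (≔-same j) (trans y≡fi (≡.sym (≔-other i≢j))))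

    swap⁺ : ∀ {f y} → G [ y ~ f e ] → (∀ i → i < k → y ≢ f i) → ¬ T (f e) (f j) → T (f e) y → Sat G (swap e j θ) f
    swap⁺ {f} {y} y~e y≢ ¬T Ty = ¬T ∘ to (θ⇔ f) , y
      , ≡.subst₂ (G [_~_]) (≡.sym (≔-same j)) (≡.sym (≔-other (j≢e ∘ ≡.sym))) y~e
      , ⋀⁺ {G} {λ i → ¬' (j =' i)} (others j) (λ {i} i∈ eq → let i<k , i≢j = others⁻ i∈ in
          y≢ i i<k (trans (≡.sym (≔-same j)) (trans eq (≔-other i≢j))))
      , from (θ⇔ _) (≡.subst₂ T (≡.sym (≔-other (j≢e ∘ ≡.sym))) (≡.sym (≔-same j)) Ty)

  -- An outside neighbour of `e` is always adjacent to `e`, so adjacency separates it from the old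
  -- value of `j` in one direction only; exposure may do so in either.
  swaps : ℕ → ℕ → Formula
  swaps e j = swap e j (j ~' e) ∨' (swap e j (exposed e j) ∨' swap e j (¬' exposed e j))

  attached : ℕ → ℕ → Formula
  attached e j = (j ~' e) ∧' exposed e j

  -- The last disjunct does not provide an outside neighbour of e, but implies directly that there is a long path.
  extendable : ℕ → Formula
  extendable e = ⋁ (others e) (swaps e) ∨' (dominates (proj₁ (third e e)) e ∨' ⋀ (others e) (attached e))

  AllAttached : (G : Graph) → (ℕ → V G) → ℕ → Set
  AllAttached G f e = ∀ {j} → j < k → j ≢ e → G [ f j ~ f e ] × Exposed G (f e) (f j)

  module _ {G : Graph} (f : ℕ → V G) (e : ℕ) (e<k : e < k) where

    extendable⁻ : 3 + n ≤ size G → Sat G (extendable e) f → HasOutside G k f e ⊎ AllAttached G f e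
    extendable⁻ big (inj₁ some)
      with j , j∈ , sat ← ⋁⁻ {G} {swaps e} {f} (others e) some
      with _ , j≢e ← others⁻ {j} {e} j∈
      with sat
    ... | inj₁ sw = inj₁ (swap⁻ G e j (j ~' e) (λ u v → G [ v ~ u ]) (λ _ → ⇔ₚ.refl) j≢e e<k sw)
    ... | inj₂ (inj₁ sw) = inj₁ (swap⁻ G e j (exposed e j) (Exposed G) (λ g → exposed⇔ G g e j) j≢e e<k sw)
    ... | inj₂ (inj₂ sw) = inj₁ (swap⁻ G e j (¬' exposed e j) (λ u v → ¬ Exposed G u v) (λ g → ¬-⇔ (exposed⇔ G g e j)) j≢e e<k sw)
    -- A dominating end is adjacent to every vertex outside the path, and the graph has more than
    -- `k` vertices.
    extendable⁻ big (inj₂ (inj₁ dom))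
      with t , t∉ ← vertexOutside (applyUpTo f k)
                      (subst (_< size G) (≡.sym (Listₚ.length-applyUpTo f k)) (ℕₚ.<-trans (ℕₚ.n<1+n k) big))
      with to (dominates⇔ {G} (proj₁ (proj₂ (proj₂ (third e e))))) dom t
    ... | inj₁ t≡fe = contradiction (subst (_∈ applyUpTo f k) (≡.sym t≡fe) (∈ₚ.∈-applyUpTo⁺ f e<k)) t∉
    ... | inj₂ t~fe = inj₁ (t , t~fe , λ i i<k t≡fi →
            t∉ (subst (_∈ applyUpTo f k) (≡.sym t≡fi) (∈ₚ.∈-applyUpTo⁺ f i<k)))
    extendable⁻ big (inj₂ (inj₂ all)) = inj₂ λ {j} j<k j≢e →
      let j~e , exp = ⋀⁻ {G} {attached e} {f} (others e) all (others⁺ j<k j≢e) in j~e , to (exposed⇔ G f e j) exp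

    extendable⁺ : Connected G → HasOutside G k f e → Sat G (extendable e) f
    extendable⁺ conn (y , y~e , y≢)
      with sat? G (⋁ (others e) (swaps e)) f | sat? G (dominates (proj₁ (third e e)) e) f
    ... | yes some | _ = inj₁ some
    ... | no _ | yes dom = inj₂ (inj₁ dom)
    ... | no none | no ¬dom = inj₂ (inj₂ (⋀⁺ {G} {attached e} {f} (others e) λ {j} j∈ →
            let j<k , j≢e = others⁻ j∈ in adjacent-e j<k j≢e , from (exposed⇔ G f e j) (exposed-e j<k j≢e)))
      where
      noSwap : ∀ {j} → j < k → j ≢ e → ¬ Sat G (swaps e j) f
      noSwap j<k j≢e sw = none (⋁⁺ {G} {swaps e} {f} (others⁺ j<k j≢e) sw)
      adjacent-e : ∀ {j} → j < k → j ≢ e → G [ f j ~ f e ]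
      adjacent-e {j} j<k j≢e = decidable-stable (adj G (f j) (f e) Boolₚ.≟ true) λ j≁e →
        noSwap j<k j≢e (inj₁ (swap⁺ G e j (j ~' e) (λ u v → G [ v ~ u ]) (λ _ → ⇔ₚ.refl) j≢e y~e y≢ j≁e y~e))
      exposed? : ∀ w → Dec (Exposed G (f e) w)
      exposed? w = Finₚ.any? λ z → (adj G z w Boolₚ.≟ true) ×-dec ¬? (near? G (f e) z)
      exposed-e : ∀ {j} → j < k → j ≢ e → Exposed G (f e) (f j)
      -- Suppose `f j` is not exposed. As no swap at `j` is possible, no outside neighbour of `e` is
      -- exposed, in particular not `y`. So the exposed neighbour `c` is some `f i` on the path, and
      -- `y`, not being exposed, could be swapped in at `i`.
      exposed-e {j} j<k j≢e = decidable-stable (exposed? (f j)) λ ¬exp →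
        let c , c~e , c-exp = exposedNeighbour conn (¬dom ∘ from (dominates⇔ {G} (proj₁ (proj₂ (proj₂ (third e e))))))
            noExposedOutside : ∀ {x} → G [ x ~ f e ] → (∀ i → i < k → x ≢ f i) → ¬ Exposed G (f e) x
            noExposedOutside x~e x≢ x-exp = noSwap j<k j≢e
              (inj₂ (inj₁ (swap⁺ G e j (exposed e j) (Exposed G) (λ g → exposed⇔ G g e j) j≢e x~e x≢ ¬exp x-exp)))
        in noExposedOutside c~e (λ i i<k c≡fi →
             noSwap {i} i<k (λ { refl → ~⇒≢ G c~e c≡fi })
               (inj₂ (inj₂ (swap⁺ G e i (¬' exposed e i) (λ u v → ¬ Exposed G u v) (λ g → ¬-⇔ (exposed⇔ G g e i))
                 (λ { refl → ~⇒≢ G c~e c≡fi }) y~e y≢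
                 (λ ¬exp-i → ¬exp-i (subst (Exposed G (f e)) c≡fi c-exp)) (noExposedOutside y~e y≢)))))
             c-exp

  module _ {G : Graph} (conn : Connected G) (big : 3 + n ≤ size G) {f : ℕ → V G} (p : IsPath G k f) where

    -- All path vertices other than f e are adjacent to f e,
    -- so their exposing neighbours are outside the path.
    exposedEnds⇒path : ∀ {e i j ys} → AllAttached G f e → i < k → i ≢ e → j < k → j ≢ e →
      Walk G (f i) ys (f j) → applyUpTo f k ↭ ys → HasPath G (3 + n)
    exposedEnds⇒path {e} {i} {j} {ys} attached i<k i≢e j<k j≢e walk perm =
      let _ , y , y~ , y-far = attached i<k i≢e
          _ , z , z~ , z-far = attached j<k j≢e
      in subst (HasPath G) (cong (2 +_) len) (extendBothEnds conn
        (subst (λ l → 2 + l ≤ size G) (≡.sym len) big)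
        walk (unique-resp-↭ {G} perm (path-unique {G} p)) (far y-far) y~ (far z-far) (~-sym G z~))
      where
      len : length ys ≡ k
      len = trans (≡.sym (↭ₚ.↭-length perm)) (Listₚ.length-applyUpTo f k)
      far : ∀ {y} → ¬ Near G (f e) y → y ∉ ys
      far {y} y-far y∈ with l , l<k , refl ← ∈ₚ.∈-applyUpTo⁻ f (↭ₚ.∈-resp-↭ (↭-sym perm) y∈) with l ≟ e
      ... | yes refl = y-far (inj₁ refl)
      ... | no l≢e = y-far (inj₂ (proj₁ (attached l<k l≢e)))

    -- The edge between `f n` and `f 0` allows the order `f n, f 0, …, f (n - 1)`; both new ends
    -- differ from `f 0` and are therefore exposed.
    firstAttached⇒path : AllAttached G f 0 → HasPath G (3 + n)
    firstAttached⇒path attached = exposedEnds⇒path {i = n} {j = 1 + m} attached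
      ℕₚ.≤-refl (λ ()) (ℕₚ.m<n+m (1 + m) {2} z<s) (λ ())
      (go (proj₁ (attached {n} ℕₚ.≤-refl λ ())) (path-walk (init-path p)))
      (subst (_↭ f n ∷ applyUpTo f n) (Listₚ.applyUpTo-∷ʳ f n) (↭ₚ.++-comm (applyUpTo f n) [ f n ]))

    -- The mirror image, with the order `f 1, …, f n, f 0`.
    lastAttached⇒path : AllAttached G f n → HasPath G (3 + n)
    lastAttached⇒path attached = exposedEnds⇒path {i = 1} {j = 0} attached
      (s<s z<s) (λ ()) z<s (λ ())
      (walk-++ (path-walk (tail-path p)) (~-sym G (proj₁ (attached {0} z<s λ ()))) (stop (f 0)))
      (↭ₚ.++-comm [ f 0 ] (applyUpTo (f ∘ suc) n))

    extendableEnds⇒path : Sat G (extendable 0) f → Sat G (extendable n) f → HasPath G (3 + n)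
    extendableEnds⇒path first last
      with extendable⁻ {G} f 0 z<s big first | extendable⁻ {G} f n ℕₚ.≤-refl big last
    ... | inj₂ attached | _ = firstAttached⇒path attached
    ... | inj₁ _ | inj₂ attached = lastAttached⇒path attached
    ... | inj₁ y | inj₁ z = outsideEnds⇒path {G} conn big p y z

  third<k : ∀ e j → proj₁ (third e j) < k
  third<k e j = ℕₚ.≤-trans (proj₁ (proj₂ (third e j))) (ℕₚ.m≤m+n 3 m)

  exposed-below : ∀ e j → e < k → j < k → VarsBelow k (exposed e j)
  exposed-below e j e<k j<k = z<k ∷ z<k ∷ j<k ∷ z<k ∷ e<k ∷ z<k ∷ e<k ∷ []
    where z<k = third<k e j

  swap-below : ∀ e j θ → e < k → j < k → VarsBelow k θ → VarsBelow k (swap e j θ)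
  swap-below e j θ e<k j<k θ<k = Allₚ.++⁺ θ<k (j<k ∷ j<k ∷ e<k ∷
    Allₚ.++⁺ (avoids-below {k} {j} (others j) z<s j<k (proj₁ ∘ others⁻ {j = j})) θ<k)

  swaps-below : ∀ e j → e < k → j < k → VarsBelow k (swaps e j)
  swaps-below e j e<k j<k = Allₚ.++⁺ (swap-below e j (j ~' e) e<k j<k (j<k ∷ e<k ∷ [])) (Allₚ.++⁺
    (swap-below e j (exposed e j) e<k j<k (exposed-below e j e<k j<k))
    (swap-below e j (¬' exposed e j) e<k j<k (exposed-below e j e<k j<k)))

  extendable-below : ∀ e → e < k → VarsBelow k (extendable e)
  extendable-below e e<k = Allₚ.++⁺
    (⋁-below z<s (others e) (swaps e) λ {j} j∈ → swaps-below e j e<k (proj₁ (others⁻ {j} {e} j∈)))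
    (z<k ∷ z<k ∷ e<k ∷ z<k ∷ e<k ∷
      ⋀-below z<s (others e) (attached e) λ {j} j∈ → let j<k = proj₁ (others⁻ {j} {e} j∈) in
        j<k ∷ e<k ∷ exposed-below e j e<k j<k)
    where z<k = third<k e e

  body : Formula
  body = isPath n ∧' (extendable 0 ∧' extendable n)

  body-below : VarsBelow k body
  body-below = Allₚ.++⁺ (isPath-below n) (Allₚ.++⁺ (extendable-below 0 z<s) (extendable-below n ℕₚ.≤-refl))

  narrow : Formula
  narrow = ∃s k body

  narrow-defines : DefinesAsympConn narrow (P (3 + n))
  narrow-defines = ∃s-defines (2 + n) k body (fv-below body body-below)
    (λ {G} conn big (path , first , last) → extendableEnds⇒path {G} conn big (isPath⁻ {G} path) first last)
    (λ {G} {h} conn big p → h ∘ suc , isPath⁺ {G} (innerPath {G} p)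
      , extendable⁺ {G} (h ∘ suc) 0 z<s conn (firstOutside {G} p)
      , extendable⁺ {G} (h ∘ suc) n ℕₚ.≤-refl conn (lastOutside {G} p))

  narrow-width : width narrow ≤ k
  narrow-width = width-below narrow (∃s-below k body ℕₚ.≤-refl body-below)

-- Width for the paths on 3 and 4 vertices

P₃-body : Formula
P₃-body = 0 =' 0

-- Every connected graph with at least 3 vertices contains `P 3`, so a tautology in one variable
-- will do.
P₃-defines : DefinesAsympConn (∃s 1 P₃-body) (P 3)
P₃-defines = ∃s-defines 2 1 P₃-body (z<s ∷ z<s ∷ []) (λ {G} {f} → sound {G} {f}) (λ {G} {h} _ _ _ → h , refl)
  where
  sound : ∀ {G f} → Connected G → 3 ≤ size G → Sat G P₃-body f → HasPath G 3
  sound {G} {f} conn big _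
    with t , t∉ ← vertexOutside [ f 0 ] (ℕₚ.<-trans (ℕₚ.n<1+n 1) big)
    with _ , d , refl , d≢ , c~d ← boundaryEdge {G} (λ v → v Finₚ.≟ f 0) (conn (f 0) t) refl (λ t≡ → t∉ (Any.here t≡))
    -- The one-vertex path `f 0` has `d` as outside neighbour at both of its coinciding ends.
    = extendBothEnds conn big (stop (f 0)) ([] ∷ []) d∉ (~-sym G c~d) d∉ c~d
    where
    d∉ : d ∉ [ f 0 ]
    d∉ (Any.here d≡) = d≢ d≡

-- Among the large connected graphs, only the stars avoid P₄, and
-- these are the graphs in which exactly one end of every edge is a dominating vertex.
P₄-body : Formula
P₄-body = (0 ~' 1) ∧' ((dominates 1 0 ∧' dominates 0 1) ∨' ((¬' dominates 1 0) ∧' (¬' dominates 0 1)))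

P₄-below : VarsBelow 2 P₄-body
P₄-below = toWitness {a? = All.all? (_<? 2) (vars P₄-body)} _

module _ {G : Graph} where

  Dominating : V G → Set
  Dominating u = ∀ v → Near G u v

  dominating? : Decidable Dominating
  dominating? u = Finₚ.all? (near? G u)

  Balanced : V G → V G → Set
  Balanced u v = (Dominating u × Dominating v) ⊎ (¬ Dominating u × ¬ Dominating v)

  balanced⇔ : ∀ f → Sat G ((dominates 1 0 ∧' dominates 0 1) ∨' ((¬' dominates 1 0) ∧' (¬' dominates 0 1))) f
                    ⇔ Balanced (f 0) (f 1)
  balanced⇔ f = ⊎-⇔ (×-⇔ dom₀ dom₁) (×-⇔ (¬-⇔ dom₀) (¬-⇔ dom₁))
    where
    dom₀ : Sat G (dominates 1 0) f ⇔ Dominating (f 0)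
    dom₀ = dominates⇔ {G} {f} {1} {0} λ ()
    dom₁ : Sat G (dominates 0 1) f ⇔ Dominating (f 1)
    dom₁ = dominates⇔ {G} {f} {0} {1} λ ()

  balanced⁺ : ∀ {u v} → G [ u ~ v ] → Balanced u v → ∃ (Sat G P₄-body)
  balanced⁺ {u} {v} u~v balanced = f , u~v , from (balanced⇔ f) balanced
    where
    f : ℕ → V G
    f zero = u
    f (suc _) = v

  -- If the middle edge is unbalanced, say `h 1` dominates and `h 2` does not, then `h 3` forms a
  -- balanced edge with `h 1` if it dominates and with `h 2` otherwise.
  P₄-complete : ∀ {h} → IsPath G 4 h → ∃ (Sat G P₄-body)
  P₄-complete {h} p with dominating? (h 1) | dominating? (h 2)
  ... | yes d₁ | yes d₂ = balanced⁺ (adjacent p 1 (s<s (s<s z<s))) (inj₁ (d₁ , d₂))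
  ... | no ¬d₁ | no ¬d₂ = balanced⁺ (adjacent p 1 (s<s (s<s z<s))) (inj₂ (¬d₁ , ¬d₂))
  ... | yes d₁ | no ¬d₂ with dominating? (h 3) | d₁ (h 3)
  ...   | no ¬d₃ | _ = balanced⁺ (adjacent p 2 ℕₚ.≤-refl) (inj₂ (¬d₂ , ¬d₃))
  ...   | yes d₃ | inj₁ eq = contradiction (≡.sym eq) (distinct p 1 3 (s<s z<s) ℕₚ.≤-refl)
  ...   | yes d₃ | inj₂ h₃~h₁ = balanced⁺ h₃~h₁ (inj₁ (d₃ , d₁))
  P₄-complete {h} p | no ¬d₁ | yes d₂ with dominating? (h 0) | d₂ (h 0)
  ...   | no ¬d₀ | _ = balanced⁺ (adjacent p 0 (s<s z<s)) (inj₂ (¬d₀ , ¬d₁))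
  ...   | yes d₀ | inj₁ eq = contradiction eq (distinct p 0 2 z<s (s<s (s<s z<s)))
  ...   | yes d₀ | inj₂ h₀~h₂ = balanced⁺ h₀~h₂ (inj₁ (d₀ , d₂))

  module _ (conn : Connected G) (big : 4 ≤ size G) where

    ∉-pair : ∀ {x u v : V G} → x ≢ u → x ≢ v → x ∉ u ∷ v ∷ []
    ∉-pair x≢u x≢v (Any.here eq) = x≢u eq
    ∉-pair x≢u x≢v (Any.there (Any.here eq)) = x≢v eq

    extendEdge : ∀ {u v y z} → G [ u ~ v ] → G [ y ~ u ] → y ≢ v → G [ z ~ v ] → z ≢ u → HasPath G 4
    extendEdge {u} {v} u~v y~u y≢v z~v z≢u = extendBothEnds conn big (go u~v (stop v))
      ((~⇒≢ G u~v ∷ []) ∷ [] ∷ []) (∉-pair (~⇒≢ G y~u) y≢v) y~u (∉-pair z≢u (~⇒≢ G z~v)) (~-sym G z~v)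

    -- A vertex outside N[v] is reached through some exposed c ~ v; c ≠ u unless u has a neighbour besides v.
    nondominatingEnd⇒path : ∀ {u v} → G [ u ~ v ] → (∀ y → G [ y ~ u ] → y ≡ v) → ¬ Dominating v → HasPath G 4
    nondominatingEnd⇒path {u} {v} u~v pendant ¬dom
      with c , c~v , d , d~c , d-far ← exposedNeighbour conn ¬dom =
      extendEdge (~-sym G c~v) u~v (λ { refl → d-far (inj₁ (pendant d d~c)) }) d~c (λ d≡v → d-far (inj₁ d≡v))

    otherNeighbour : ∀ u v → (∃ λ y → G [ y ~ u ] × y ≢ v) ⊎ (∀ y → G [ y ~ u ] → y ≡ v)
    otherNeighbour u v with Finₚ.any? (λ y → (adj G y u Boolₚ.≟ true) ×-dec ¬? (y Finₚ.≟ v))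
    ... | yes found = inj₁ found
    ... | no none = inj₂ λ y y~u → decidable-stable (y Finₚ.≟ v) λ y≢v → none (y , y~u , y≢v)

    -- If both ends dominate, any third vertex is an outside neighbour of both. If neither does,
    -- both have a further neighbour, or one is pendant and `nondominatingEnd⇒path` applies to the
    -- other.
    P₄-sound : ∀ {u v} → G [ u ~ v ] → Balanced u v → HasPath G 4
    P₄-sound {u} {v} u~v (inj₁ (dom-u , dom-v))
      with t , t∉ ← vertexOutside (u ∷ v ∷ []) (ℕₚ.<-trans (ℕₚ.n<1+n 2) big) with dom-u t | dom-v t
    ... | inj₁ t≡u | _ = contradiction (Any.here t≡u) t∉
    ... | inj₂ _ | inj₁ t≡v = contradiction (Any.there (Any.here t≡v)) t∉
    ... | inj₂ t~u | inj₂ t~v =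
      extendEdge u~v t~u (λ t≡v → t∉ (Any.there (Any.here t≡v))) t~v (λ t≡u → t∉ (Any.here t≡u))
    P₄-sound {u} {v} u~v (inj₂ (¬dom-u , ¬dom-v)) with otherNeighbour u v | otherNeighbour v u
    ... | inj₂ pendant | _ = nondominatingEnd⇒path u~v pendant ¬dom-v
    ... | inj₁ _ | inj₂ pendant = nondominatingEnd⇒path (~-sym G u~v) pendant ¬dom-u
    ... | inj₁ (y , y~u , y≢v) | inj₁ (z , z~v , z≢u) = extendEdge u~v y~u y≢v z~v z≢u

P₄-defines : DefinesAsympConn (∃s 2 P₄-body) (P 4)
P₄-defines = ∃s-defines 3 2 P₄-body (fv-below P₄-body P₄-below)
  (λ {G} {f} conn big (u~v , balanced) → P₄-sound {G} conn big u~v (to (balanced⇔ {G} f) balanced))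
  (λ {G} _ _ → P₄-complete {G})

-- The exact values of depth and width

vars-nonempty : ∀ φ → 1 ≤ length (vars φ)
vars-nonempty (x ~' y) = s≤s z≤n
vars-nonempty (x =' y) = s≤s z≤n
vars-nonempty (¬' φ) = vars-nonempty φ
vars-nonempty (φ ∧' ψ) = ℕₚ.≤-trans (vars-nonempty φ)
  (subst (length (vars φ) ≤_) (≡.sym (Listₚ.length-++ (vars φ))) (ℕₚ.m≤m+n _ _))
vars-nonempty (φ ∨' ψ) = ℕₚ.≤-trans (vars-nonempty φ)
  (subst (length (vars φ) ≤_) (≡.sym (Listₚ.length-++ (vars φ))) (ℕₚ.m≤m+n _ _))
vars-nonempty (∃' x φ) = s≤s z≤n
vars-nonempty (∀' x φ) = s≤s z≤n

width-positive : ∀ φ → 1 ≤ width φ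
width-positive φ with vars φ | vars-nonempty φ
... | _ ∷ _ | _ = s≤s z≤n

isD' : ∀ {F d} Φ → DefinesAsympConn Φ F → depth Φ ≤ d → (∀ Ψ → DefinesAsympConn Ψ F → d ≤ depth Ψ) → IsD' F d
isD' Φ defines upper lower = (Φ , defines , ℕₚ.≤-antisym upper (lower Φ defines)) , lower

isW' : ∀ {F w} Φ → DefinesAsympConn Φ F → width Φ ≤ w → (∀ Ψ → DefinesAsympConn Ψ F → w ≤ width Ψ) → IsW' F w
isW' Φ defines upper lower = (Φ , defines , ℕₚ.≤-antisym upper (lower Φ defines)) , lower

pathDepth : ∀ m → IsD' (P (4 + m)) (3 + m)
pathDepth m = isD' {P (4 + m)} shallow shallow-defines shallow-depth (LowerBounds.depth-bound m)
  where open ShallowSentence (1 + m)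

pathWidth : ∀ m → IsW' (P (3 + m)) (1 + m)
pathWidth zero = isW' {P 3} (∃s 1 P₃-body) P₃-defines ℕₚ.≤-refl (λ Ψ _ → width-positive Ψ)
pathWidth (suc zero) = isW' {P 4} (∃s 2 P₄-body) P₄-defines ℕₚ.≤-refl (LowerBounds.width-bound 0)
pathWidth (suc (suc m)) = isW' {P (5 + m)} narrow narrow-defines narrow-width (LowerBounds.width-bound (suc m))
  where open NarrowSentence m

theorem4 : ((ℓ : ℕ) → 4 ≤ ℓ → IsD' (P ℓ) (ℓ ∸ 1))
    × ((ℓ : ℕ) → 3 ≤ ℓ → IsW' (P ℓ) (ℓ ∸ 2))
theorem4 =
    (λ { _ (s≤s (s≤s (s≤s (s≤s (z≤n {m}))))) → pathDepth m })
  , (λ { _ (s≤s (s≤s (s≤s (z≤n {m})))) → pathWidth m })
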